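{- For every integer $k\ge1$, $$E^{(k-1)(k-2)\cdots1k}_{3\text{ - }21}(x)=\begin{cases}0,&\text{if }k\ge4,\\[1mm] \dfrac{e^{e^x}}{(k-1)!}\displaystyle\int_0^x t^{k-1}e^{ -e^t+t}\,dt,&\text{if }k=2\text{ or }k=3,\\[2mm] e^{e^x-1},&\text{if }k=1.\end{cases}$$
   Context: A permutation $\pi=\pi_1\cdots\pi_n$ of $\{1,\dots,n\}$ contains the generalized pattern $3\text{ - }21$ if there are indices $i<j<n$ such that $\pi_i\pi_j\pi_{j+1}$ is order-isomorphic to $321$; otherwise it avoids it. A permutation $\pi$ begins with a pattern $p=p_1\cdots p_k$ if $n\ge k$ and $\pi_1\cdots\pi_k$ is order-isomorphic to $p$; by convention, the empty permutation is also regarded as beginning with the pattern $1$ (the case $k=1$). The pattern $(k-1)(k-2)\cdots1k$ consists of $k-1,k-2,\dots,1$ in decreasing order followed by $k$ (for $k=1$ it is $1$, for $k=2$ it is $12$, for $k=3$ it is $213$). $E^p_q(x)=\sum_{n\ge0}N^p_q(n)\frac{x^n}{n!}$, where $N^p_q(n)$ is the number of permutations of $\{1,\dots,n\}$ that avoid $q$ and begin with $p$. Identities are identities of power series in $x$. -}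

module Defs where

open import Algebra.Bundles using (RawSemiring)
import Algebra.Definitions.RawSemiring as RawSemiringDefinitions
open import Data.Fin.Base as Fin using (Fin; toℕ)
import Data.Fin.Properties as Fin
open import Data.Integer.Base as ℤ using (+_; -[1+_])
import Data.Integer.Properties as ℤ
open import Data.List.Base as List using (List)
open import Data.Nat.Base as ℕ using (ℕ; zero; suc; _!)
import Data.Nat.Properties as ℕ
open import Data.Nat.Properties using (_!≢0)
import Data.Nat.Coprimality as Coprime
open import Data.Product.Base using (Σ; ∃; _×_; _,_; proj₁; proj₂)
open import Data.Rational.Base as ℚ using (ℚ; 0ℚ; 1ℚ; ½; mkℚ; ∣_∣; _/_)
import Data.Rational.Properties as ℚ
open import Data.Rational.Solver using (module +-*-Solver)
import Data.Rational.Unnormalised.Base as ℚᵘ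
import Data.Rational.Unnormalised.Properties as ℚᵘ
open import Data.Sum.Base using (_⊎_)
open import Data.Vec.Base using (Vec; []; _∷_; _∷ʳ_; map; lookup; truncate)
open import Data.Vec.Relation.Unary.AllPairs using (allPairs?)
open import Data.Vec.Relation.Unary.Unique.Propositional using (Unique)
open import Function.Base using (_∘_)
open import Level using (0ℓ)
open import Relation.Binary.PropositionalEquality
open import Relation.Nullary.Negation.Core using (¬_)
open import Relation.Nullary.Decidable
  using (Dec; yes; no; map′; ¬?; _×-dec_; _⊎-dec_; _→-dec_)
open import Relation.Unary using (Decidable)

-- A permutation of n letters is written in one-line notation, as a word
-- π₁ ⋯ πₙ without repetition.  Letters and positions are counted from 0.

Word : ℕ → Set
Word n = Vec (Fin n) n

words : ∀ n m → List (Vec (Fin n) m)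
words n zero    = List.[ [] ]
words n (suc m) = List.cartesianProductWith _∷_ (List.allFin n) (words n m)

OrderIsomorphic : ∀ {k} → Vec ℕ k → Vec ℕ k → Set
OrderIsomorphic u v = ∀ i j →
  (lookup u i ℕ.< lookup u j → lookup v i ℕ.< lookup v j) ×
  (lookup v i ℕ.< lookup v j → lookup u i ℕ.< lookup u j)

Contains3-21 : ∀ {n} → Word n → Set
Contains3-21 {n} π =
  Σ (Fin n) λ i → Σ (Fin n) λ j → Σ (Fin n) λ j⁺ →
  i Fin.< j × toℕ j⁺ ≡ suc (toℕ j) ×
  OrderIsomorphic
    (toℕ (lookup π i) ∷ toℕ (lookup π j) ∷ toℕ (lookup π j⁺) ∷ [])
    (3 ∷ 2 ∷ 1 ∷ [])

-- The second summand is the convention that the empty permutation begins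
-- with the pattern 1, the only pattern of length 1.

BeginsWith : ∀ {k n} → Vec ℕ k → Word n → Set
BeginsWith {k} {n} p π =
  (Σ (k ℕ.≤ n) λ k≤n → OrderIsomorphic (map toℕ (truncate k≤n π)) p)
  ⊎ (k ≡ 1 × n ≡ 0)

descending : ∀ m → Vec ℕ m
descending zero    = []
descending (suc m) = suc m ∷ descending m

-- (k-1)(k-2)⋯1k; the value at k = 0 is a dummy.

pattern-k : ∀ k → Vec ℕ k
pattern-k zero    = []
pattern-k (suc m) = descending m ∷ʳ suc m

orderIsomorphic? : ∀ {k} (u v : Vec ℕ k) → Dec (OrderIsomorphic u v)
orderIsomorphic? u v = Fin.all? λ i → Fin.all? λ j →
  (lookup u i ℕ.<? lookup u j →-dec lookup v i ℕ.<? lookup v j) ×-dec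
  (lookup v i ℕ.<? lookup v j →-dec lookup u i ℕ.<? lookup u j)

contains3-21? : ∀ {n} → Decidable (Contains3-21 {n})
contains3-21? π = Fin.any? λ i → Fin.any? λ j → Fin.any? λ j⁺ →
  i Fin.<? j ×-dec toℕ j⁺ ℕ.≟ suc (toℕ j) ×-dec
  orderIsomorphic?
    (toℕ (lookup π i) ∷ toℕ (lookup π j) ∷ toℕ (lookup π j⁺) ∷ [])
    (3 ∷ 2 ∷ 1 ∷ [])

beginsWith? : ∀ {k n} (p : Vec ℕ k) → Decidable (BeginsWith {k} {n} p)
beginsWith? {k} {n} p π = prefix? ⊎-dec (k ℕ.≟ 1 ×-dec n ℕ.≟ 0)
  where
  Prefix : k ℕ.≤ n → Set
  Prefix k≤n = OrderIsomorphic (map toℕ (truncate k≤n π)) p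

  prefix? : Dec (Σ (k ℕ.≤ n) Prefix)
  prefix? with k ℕ.≤? n
  ... | no  k≰n = no (k≰n ∘ proj₁)
  ... | yes k≤n = map′ (k≤n ,_)
    (λ (k≤n′ , h) → subst Prefix (ℕ.≤-irrelevant k≤n′ k≤n) h)
    (orderIsomorphic? (map toℕ (truncate k≤n π)) p)

Counted : ∀ {k n} → Vec ℕ k → Word n → Set
Counted p π = Unique π × ¬ Contains3-21 π × BeginsWith p π

counted? : ∀ {k n} (p : Vec ℕ k) → Decidable (Counted {k} {n} p)
counted? p π =
  allPairs? (λ a b → ¬? (a Fin.≟ b)) π ×-dec ¬? (contains3-21? π) ×-dec
  beginsWith? p π

N : ∀ {k} → Vec ℕ k → ℕ → ℕ
N p n = List.length (List.filter (counted? p) (words n n))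

module Series {c ℓ} (R : RawSemiring c ℓ) where

  open RawSemiring R
  open RawSemiringDefinitions R using () renaming (sum to ∑)

  one : ℕ → Carrier
  one zero    = 1#
  one (suc _) = 0#

  rawSemiring : RawSemiring c ℓ
  rawSemiring = record
    { Carrier = ℕ → Carrier
    ; _≈_     = λ f g → ∀ n → f n ≈ g n
    ; _+_     = λ f g n → f n + g n
    ; _*_     = λ f g n → ∑ {suc n} λ i → f (toℕ i) * g (n ℕ.∸ toℕ i)
    ; 0#      = λ _ → 0#
    ; 1#      = one
    }

open import Data.Rational.Base using (_<_; _≤_; _+_; _*_; _-_; -_)

IsCauchy : (ℕ → ℚ) → Set
IsCauchy a = ∀ ε → 0ℚ < ε →
  ∃ λ M → ∀ m n → M ℕ.≤ m → M ℕ.≤ n → ∣ a m - a n ∣ < ε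

-- Real coefficients are needed because the constant term of e^(e^x) is e.
-- A real number is a Cauchy sequence of rationals, up to _≈ʳ_.

record ℝ : Set where
  field
    seq    : ℕ → ℚ
    cauchy : IsCauchy seq

open ℝ public

infix 4 _≈ʳ_

_≈ʳ_ : ℝ → ℝ → Set
x ≈ʳ y = ∀ ε → 0ℚ < ε →
  ∃ λ M → ∀ n → M ℕ.≤ n → ∣ seq x n - seq y n ∣ < ε

module Estimates where

  ½*-pos : ∀ {ε} → 0ℚ < ε → 0ℚ < ½ * ε
  ½*-pos {ε} 0<ε = subst (_< ½ * ε) (ℚ.*-zeroʳ ½) (ℚ.*-monoʳ-<-pos ½ 0<ε)

  halves : ∀ ε → ½ * ε + ½ * ε ≡ ε
  halves ε = trans (sym (ℚ.*-distribʳ-+ ε ½ ½)) (ℚ.*-identityˡ ε)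

  ⊔-≤ˡ : ∀ m k {n} → m ℕ.⊔ k ℕ.≤ n → m ℕ.≤ n
  ⊔-≤ˡ m k = ℕ.≤-trans (ℕ.m≤m⊔n m k)

  ⊔-≤ʳ : ∀ m k {n} → m ℕ.⊔ k ℕ.≤ n → k ℕ.≤ n
  ⊔-≤ʳ m k = ℕ.≤-trans (ℕ.m≤n⊔m m k)

  const-cauchy : ∀ q → IsCauchy (λ _ → q)
  const-cauchy q ε 0<ε = 0 , λ _ _ _ _ →
    subst (_< ε) (cong ∣_∣ (sym (ℚ.+-inverseʳ q))) 0<ε

  +-cauchy : ∀ a b → IsCauchy a → IsCauchy b → IsCauchy (λ n → a n + b n)
  +-cauchy a b ca cb ε 0<ε
    with ca (½ * ε) (½*-pos 0<ε) | cb (½ * ε) (½*-pos 0<ε)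
  ... | M₁ , h₁ | M₂ , h₂ = M₁ ℕ.⊔ M₂ , λ m n M≤m M≤n → begin-strict
    ∣ (a m + b m) - (a n + b n) ∣
      ≡⟨ cong ∣_∣ (rearrange (a m) (b m) (a n) (b n)) ⟩
    ∣ (a m - a n) + (b m - b n) ∣
      ≤⟨ ℚ.∣p+q∣≤∣p∣+∣q∣ (a m - a n) (b m - b n) ⟩
    ∣ a m - a n ∣ + ∣ b m - b n ∣
      <⟨ ℚ.+-mono-< (h₁ m n (l M≤m) (l M≤n)) (h₂ m n (r M≤m) (r M≤n)) ⟩
    ½ * ε + ½ * ε
      ≡⟨ halves ε ⟩
    ε ∎
    where
    open ℚ.≤-Reasoning
    l : ∀ {n} → M₁ ℕ.⊔ M₂ ℕ.≤ n → M₁ ℕ.≤ n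
    l = ⊔-≤ˡ M₁ M₂
    r : ∀ {n} → M₁ ℕ.⊔ M₂ ℕ.≤ n → M₂ ℕ.≤ n
    r = ⊔-≤ʳ M₁ M₂
    rearrange : ∀ p q s t → (p + q) - (s + t) ≡ (p - s) + (q - t)
    rearrange = solve 4 (λ p q s t →
      (p :+ q) :- (s :+ t) := (p :- s) :+ (q :- t)) refl
      where open +-*-Solver

  0<1 : 0ℚ < 1ℚ
  0<1 = ℚ.positive⁻¹ 1ℚ

  p≤p+q : ∀ p {q} → 0ℚ ≤ q → p ≤ p + q
  p≤p+q p {q} 0≤q = subst (_≤ p + q) (ℚ.+-identityʳ p) (ℚ.+-monoʳ-≤ p 0≤q)

  p≤q+p : ∀ p {q} → 0ℚ ≤ q → p ≤ q + p
  p≤q+p p {q} 0≤q = subst (_≤ q + p) (ℚ.+-identityˡ p) (ℚ.+-monoˡ-≤ p 0≤q)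

  bounded : ∀ a → IsCauchy a →
    ∃ λ B → 0ℚ < B × ∃ λ M → ∀ n → M ℕ.≤ n → ∣ a n ∣ ≤ B
  bounded a ca with ca 1ℚ 0<1
  ... | M , h = ∣ a M ∣ + 1ℚ
      , ℚ.<-≤-trans 0<1 (p≤q+p 1ℚ (ℚ.0≤∣p∣ (a M)))
      , M , λ n M≤n → begin
        ∣ a n ∣                       ≡⟨ cong ∣_∣ (split (a n) (a M)) ⟩
        ∣ a M + (a n - a M) ∣         ≤⟨ ℚ.∣p+q∣≤∣p∣+∣q∣ (a M) (a n - a M) ⟩
        ∣ a M ∣ + ∣ a n - a M ∣       <⟨ ℚ.+-monoʳ-< ∣ a M ∣ (h n M M≤n ℕ.≤-refl) ⟩
        ∣ a M ∣ + 1ℚ                  ∎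
    where
    open ℚ.≤-Reasoning
    split : ∀ p q → p ≡ q + (p - q)
    split = solve 2 (λ p q → p := q :+ (p :- q)) refl
      where open +-*-Solver

  *-bound : ∀ x y {B δ} → ∣ x ∣ ≤ B → 0ℚ < B → ∣ y ∣ < δ → ∣ x * y ∣ < B * δ
  *-bound x y {B} {δ} x≤B 0<B y<δ = begin-strict
    ∣ x * y ∣      ≡⟨ ℚ.∣p*q∣≡∣p∣*∣q∣ x y ⟩
    ∣ x ∣ * ∣ y ∣  ≤⟨ ℚ.*-monoʳ-≤-nonNeg ∣ y ∣ {{ℚ.∣-∣-nonNeg y}} x≤B ⟩
    B * ∣ y ∣      <⟨ ℚ.*-monoʳ-<-pos B {{ℚ.positive 0<B}} y<δ ⟩
    B * δ          ∎
    where open ℚ.≤-Reasoning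

  divide : ∀ B ε → 0ℚ < B → ∃ λ δ → (0ℚ < ε → 0ℚ < δ) × B * δ ≡ ε
  divide B ε 0<B = 1/B * ε
    , (λ 0<ε → subst (_< 1/B * ε) (ℚ.*-zeroʳ 1/B)
        (ℚ.*-monoʳ-<-pos 1/B {{ℚ.1/pos⇒pos B {{ℚ.positive 0<B}}}} 0<ε))
    , trans (sym (ℚ.*-assoc B 1/B ε))
        (trans (cong (_* ε) (ℚ.*-inverseʳ B {{ℚ.>-nonZero 0<B}})) (ℚ.*-identityˡ ε))
    where 1/B = (ℚ.1/ B) {{ℚ.>-nonZero 0<B}}

  *-close : ∀ p q s t {A B δ η} → 0ℚ < A → 0ℚ < B →
    ∣ p ∣ ≤ A → ∣ t ∣ ≤ B → ∣ q - t ∣ < δ → ∣ p - s ∣ < η →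
    ∣ p * q - s * t ∣ < A * δ + B * η
  *-close p q s t {A} {B} {δ} {η} 0<A 0<B p≤A t≤B q-t<δ p-s<η =
    subst (_< A * δ + B * η) (cong ∣_∣ (sym (rearrange p q s t)))
      (ℚ.≤-<-trans (ℚ.∣p+q∣≤∣p∣+∣q∣ (p * (q - t)) (t * (p - s)))
        (ℚ.+-mono-< (*-bound p (q - t) p≤A 0<A q-t<δ)
                    (*-bound t (p - s) t≤B 0<B p-s<η)))
    where
    rearrange : ∀ p q s t → p * q - s * t ≡ p * (q - t) + t * (p - s)
    rearrange = solve 4 (λ p q s t →
      (p :* q) :- (s :* t) := p :* (q :- t) :+ t :* (p :- s)) refl
      where open +-*-Solver

  *-cauchy : ∀ a b → IsCauchy a → IsCauchy b → IsCauchy (λ n → a n * b n)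
  *-cauchy a b ca cb ε 0<ε =
    let A , 0<A , M₁ , h₁ = bounded a ca
        B , 0<B , M₂ , h₂ = bounded b cb
        δ , 0<δ , Aδ = divide A (½ * ε) 0<A
        η , 0<η , Bη = divide B (½ * ε) 0<B
        M₃ , h₃ = ca η (0<η (½*-pos 0<ε))
        M₄ , h₄ = cb δ (0<δ (½*-pos 0<ε))
        M₁₂ = M₁ ℕ.⊔ M₂
        M₃₄ = M₃ ℕ.⊔ M₄
        ≤₁ = λ {n} (h : M₁₂ ℕ.⊔ M₃₄ ℕ.≤ n) → ⊔-≤ˡ M₁ M₂ (⊔-≤ˡ M₁₂ M₃₄ h)
        ≤₂ = λ {n} (h : M₁₂ ℕ.⊔ M₃₄ ℕ.≤ n) → ⊔-≤ʳ M₁ M₂ (⊔-≤ˡ M₁₂ M₃₄ h)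
        ≤₃ = λ {n} (h : M₁₂ ℕ.⊔ M₃₄ ℕ.≤ n) → ⊔-≤ˡ M₃ M₄ (⊔-≤ʳ M₁₂ M₃₄ h)
        ≤₄ = λ {n} (h : M₁₂ ℕ.⊔ M₃₄ ℕ.≤ n) → ⊔-≤ʳ M₃ M₄ (⊔-≤ʳ M₁₂ M₃₄ h)
    in M₁₂ ℕ.⊔ M₃₄ , λ m n M≤m M≤n →
      subst (∣ a m * b m - a n * b n ∣ <_)
        (trans (cong₂ _+_ Aδ Bη) (halves ε))
        (*-close (a m) (b m) (a n) (b n) 0<A 0<B
          (h₁ m (≤₁ M≤m)) (h₂ n (≤₂ M≤n))
          (h₄ m n (≤₄ M≤m) (≤₄ M≤n)) (h₃ m n (≤₃ M≤m) (≤₃ M≤n)))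

open Estimates

ι : ℚ → ℝ
ι q = record { seq = λ _ → q ; cauchy = const-cauchy q }

ℝ-rawSemiring : RawSemiring 0ℓ 0ℓ
ℝ-rawSemiring = record
  { Carrier = ℝ
  ; _≈_     = _≈ʳ_
  ; _+_     = λ x y → record
    { seq    = λ n → seq x n + seq y n
    ; cauchy = +-cauchy (seq x) (seq y) (cauchy x) (cauchy y)
    }
  ; _*_     = λ x y → record
    { seq    = λ n → seq x n * seq y n
    ; cauchy = *-cauchy (seq x) (seq y) (cauchy x) (cauchy y)
    }
  ; 0#      = ι 0ℚ
  ; 1#      = ι 1ℚ
  }

open RawSemiringDefinitions ℚ.+-*-rawSemiring using (sum; _^_)

1/_! : ℕ → ℚ
1/ n ! = (+ 1 / (n !)) {{n !≢0}}

expTerm : ℚ → ℕ → ℚ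
expTerm q k = q ^ k * 1/ k !

expSum : ℚ → ℕ → ℚ
expSum q m = sum {suc m} λ i → expTerm q (toℕ i)

module ExpEstimates where

  # : ℕ → ℚ
  # n = mkℚ (+ n) 0 (Coprime.sym (Coprime.1-coprimeTo n))

  archimedean : ∀ q → ∃ λ j → q ≤ # j
  archimedean (mkℚ (+ n) d _) = n , ℚ.*≤* (subst₂ ℤ._≤_
    (ℤ.pos-* n 1) (ℤ.pos-* n (suc d)) (ℤ.+≤+ (ℕ.*-monoʳ-≤ n (ℕ.s≤s ℕ.z≤n))))
  archimedean (mkℚ -[1+ n ] d _) = 0 , ℚ.*≤* ℤ.-≤+

  #-suc : ∀ n → # (suc n) ≡ # n + 1ℚ
  #-suc n = ℚ.toℚᵘ-injective (ℚᵘ.≃-trans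
    (ℚᵘ.*≡* (cong (ℤ._* + 1) (trans (cong +_ (ℕ.+-comm 1 n))
      (cong (ℤ._+ + 1) (sym (ℤ.*-identityʳ (+ n)))))))
    (ℚᵘ.≃-sym (ℚ.toℚᵘ-homo-+ (# n) 1ℚ)))

  #-mono : ∀ m n → m ℕ.≤ n → # m ≤ # n
  #-mono m n m≤n = ℚ.*≤* (subst₂ ℤ._≤_ (sym (ℤ.*-identityʳ (+ m)))
    (sym (ℤ.*-identityʳ (+ n))) (ℤ.+≤+ m≤n))

  1/!-suc : ∀ k → 1/ suc k ! * # (suc k) ≡ 1/ k !
  1/!-suc k = go (k !) {{k !≢0}}
    where
    go : ∀ b .{{_ : ℕ.NonZero b}} →
      (+ 1 / (suc k ℕ.* b)) {{ℕ.m*n≢0 (suc k) b}} * # (suc k) ≡ + 1 / b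
    go (suc b) = ℚ.toℚᵘ-injective (ℚᵘ.≃-trans
      (ℚ.toℚᵘ-homo-* (ℚ.fromℚᵘ (ℚᵘ.mkℚᵘ (+ 1) c)) (# (suc k)))
      (ℚᵘ.≃-trans
        (ℚᵘ.*-congʳ {ℚ.toℚᵘ (# (suc k))} (ℚ.toℚᵘ-fromℚᵘ (ℚᵘ.mkℚᵘ (+ 1) c)))
        (ℚᵘ.≃-trans
          (ℚᵘ.*≡* (cong +_ arith))
          (ℚᵘ.≃-sym (ℚ.toℚᵘ-fromℚᵘ (ℚᵘ.mkℚᵘ (+ 1) b))))))
      where
      c = b ℕ.+ k ℕ.* suc b
      arith : (1 ℕ.* suc k) ℕ.* suc b ≡ 1 ℕ.* (suc c ℕ.* 1)
      arith = trans (cong (ℕ._* suc b) (ℕ.*-identityˡ (suc k)))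
        (sym (trans (ℕ.*-identityˡ (suc c ℕ.* 1)) (ℕ.*-identityʳ (suc c))))

  sum-suc : ∀ (f : ℕ → ℚ) n →
    sum {suc n} (λ i → f (toℕ i)) ≡ sum {n} (λ i → f (toℕ i)) + f n
  sum-suc f zero    = ℚ.+-comm (f 0) 0ℚ
  sum-suc f (suc n) = trans (cong (λ z → f 0 + z) (sum-suc (f ∘ suc) n))
    (sym (ℚ.+-assoc (f 0) (sum {n} (λ i → f (suc (toℕ i)))) (f (suc n))))

  module _ (q : ℚ) where

    open ℚ.≤-Reasoning

    t : ℕ → ℚ
    t k = ∣ expTerm q k ∣

    term-suc : ∀ k → expTerm q (suc k) * # (suc k) ≡ q * expTerm q k
    term-suc k = begin-equality
      (q * q ^ k) * 1/ suc k ! * # (suc k)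
        ≡⟨ ℚ.*-assoc (q * q ^ k) (1/ suc k !) (# (suc k)) ⟩
      (q * q ^ k) * (1/ suc k ! * # (suc k))
        ≡⟨ cong ((q * q ^ k) *_) (1/!-suc k) ⟩
      (q * q ^ k) * 1/ k !
        ≡⟨ ℚ.*-assoc q (q ^ k) (1/ k !) ⟩
      q * expTerm q k ∎

    t-suc : ∀ k → t (suc k) * # (suc k) ≡ ∣ q ∣ * t k
    t-suc k = trans (sym (ℚ.∣p*q∣≡∣p∣*∣q∣ (expTerm q (suc k)) (# (suc k))))
      (trans (cong ∣_∣ (term-suc k)) (ℚ.∣p*q∣≡∣p∣*∣q∣ q (expTerm q k)))

    0≤t : ∀ k → 0ℚ ≤ t k
    0≤t k = ℚ.0≤∣p∣ (expTerm q k)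

    M : ℕ
    M = proj₁ (archimedean (∣ q ∣ + ∣ q ∣))

    t-halves : ∀ k → M ℕ.≤ k → t (suc k) + t (suc k) ≤ t k
    t-halves k M≤k = ℚ.*-cancelʳ-≤-pos (# (suc k)) (begin
      (t (suc k) + t (suc k)) * # (suc k)
        ≡⟨ ℚ.*-distribʳ-+ (# (suc k)) (t (suc k)) (t (suc k)) ⟩
      t (suc k) * # (suc k) + t (suc k) * # (suc k)
        ≡⟨ cong₂ _+_ (t-suc k) (t-suc k) ⟩
      ∣ q ∣ * t k + ∣ q ∣ * t k
        ≡⟨ ℚ.*-distribʳ-+ (t k) ∣ q ∣ ∣ q ∣ ⟨
      (∣ q ∣ + ∣ q ∣) * t k
        ≤⟨ ℚ.*-monoʳ-≤-nonNeg (t k) {{ℚ.∣-∣-nonNeg (expTerm q k)}}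
             (ℚ.≤-trans (proj₂ (archimedean (∣ q ∣ + ∣ q ∣)))
               (#-mono M (suc k) (ℕ.m≤n⇒m≤1+n M≤k))) ⟩
      # (suc k) * t k
        ≡⟨ ℚ.*-comm (# (suc k)) (t k) ⟩
      t k * # (suc k) ∎)

    t-decay : ∀ j → # (suc j) * t (j ℕ.+ M) ≤ t M
    t-decay zero    = ℚ.≤-reflexive (ℚ.*-identityˡ (t M))
    t-decay (suc j) = begin
      # (suc (suc j)) * t′       ≡⟨ cong (_* t′) (#-suc (suc j)) ⟩
      (# (suc j) + 1ℚ) * t′
        ≤⟨ ℚ.*-monoʳ-≤-nonNeg t′ {{ℚ.∣-∣-nonNeg (expTerm q (suc j ℕ.+ M))}}
             (ℚ.+-monoʳ-≤ (# (suc j)) (#-mono 1 (suc j) (ℕ.s≤s ℕ.z≤n))) ⟩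
      (# (suc j) + # (suc j)) * t′
        ≡⟨ ℚ.*-distribʳ-+ t′ (# (suc j)) (# (suc j)) ⟩
      # (suc j) * t′ + # (suc j) * t′
        ≡⟨ ℚ.*-distribˡ-+ (# (suc j)) t′ t′ ⟨
      # (suc j) * (t′ + t′)
        ≤⟨ ℚ.*-monoˡ-≤-nonNeg (# (suc j)) (t-halves (j ℕ.+ M) (ℕ.m≤n+m M j)) ⟩
      # (suc j) * t (j ℕ.+ M)    ≤⟨ t-decay j ⟩
      t M                        ∎
      where t′ = t (suc j ℕ.+ M)

    tail : ∀ m → M ℕ.≤ m → ∀ d →
      ∣ expSum q (d ℕ.+ m) - expSum q m ∣ + t (d ℕ.+ m) ≤ t m
    tail m M≤m zero    = ℚ.≤-reflexive
      (trans (cong (λ z → ∣ z ∣ + t m) (ℚ.+-inverseʳ (expSum q m)))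
        (ℚ.+-identityˡ (t m)))
    tail m M≤m (suc d) = begin
      ∣ expSum q (suc d ℕ.+ m) - S ∣ + t′
        ≡⟨ cong (λ z → ∣ z - S ∣ + t′) (sum-suc (expTerm q) (suc d ℕ.+ m)) ⟩
      ∣ (S′ + e) - S ∣ + t′
        ≡⟨ cong (λ z → ∣ z ∣ + t′) (rearrange S′ e S) ⟩
      ∣ (S′ - S) + e ∣ + t′
        ≤⟨ ℚ.+-monoˡ-≤ t′ (ℚ.∣p+q∣≤∣p∣+∣q∣ (S′ - S) e) ⟩
      (∣ S′ - S ∣ + t′) + t′
        ≡⟨ ℚ.+-assoc ∣ S′ - S ∣ t′ t′ ⟩
      ∣ S′ - S ∣ + (t′ + t′)
        ≤⟨ ℚ.+-monoʳ-≤ ∣ S′ - S ∣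
             (t-halves (d ℕ.+ m) (ℕ.≤-trans M≤m (ℕ.m≤n+m m d))) ⟩
      ∣ S′ - S ∣ + t (d ℕ.+ m)
        ≤⟨ tail m M≤m d ⟩
      t m ∎
      where
      S  = expSum q m
      S′ = expSum q (d ℕ.+ m)
      e  = expTerm q (suc d ℕ.+ m)
      t′ = t (suc d ℕ.+ m)
      rearrange : ∀ x y z → (x + y) - z ≡ (x - z) + y
      rearrange = solve 3 (λ x y z → (x :+ y) :- z := (x :- z) :+ y) refl
        where open +-*-Solver

    t-small : ∀ ε → 0ℚ < ε → ∃ λ j → t (j ℕ.+ M) < ε
    t-small ε 0<ε =
      let r , _ , εr = divide ε (t M) 0<ε
          j , r≤j = archimedean r
      in j , ℚ.*-cancelˡ-<-nonNeg (# (suc j)) (begin-strict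
        # (suc j) * t (j ℕ.+ M)  ≤⟨ t-decay j ⟩
        t M                      ≡⟨ εr ⟨
        ε * r                    ≤⟨ ℚ.*-monoˡ-≤-nonNeg ε
                                      {{ℚ.pos⇒nonNeg ε {{ℚ.positive 0<ε}}}} r≤j ⟩
        ε * # j                  <⟨ ℚ.*-monoʳ-<-pos ε {{ℚ.positive 0<ε}} (#<#suc j) ⟩
        ε * # (suc j)            ≡⟨ ℚ.*-comm ε (# (suc j)) ⟩
        # (suc j) * ε            ∎)
      where
      #<#suc : ∀ j → # j < # (suc j)
      #<#suc j = subst₂ _<_ (ℚ.+-identityʳ (# j)) (sym (#-suc j))
        (ℚ.+-monoʳ-< (# j) 0<1)

    expSum-cauchy : IsCauchy (expSum q)
    expSum-cauchy ε 0<ε = P , λ m n P≤m P≤n → begin-strict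
      ∣ S m - S n ∣
        ≡⟨ cong ∣_∣ (rearrange (S m) (S n) (S P)) ⟩
      ∣ (S m - S P) - (S n - S P) ∣
        ≤⟨ ℚ.∣p-q∣≤∣p∣+∣q∣ (S m - S P) (S n - S P) ⟩
      ∣ S m - S P ∣ + ∣ S n - S P ∣
        <⟨ ℚ.+-mono-< (close m P≤m) (close n P≤n) ⟩
      ½ * ε + ½ * ε
        ≡⟨ halves ε ⟩
      ε ∎
      where
      S = expSum q
      small = t-small (½ * ε) (½*-pos 0<ε)
      P = proj₁ small ℕ.+ M
      close : ∀ n → P ℕ.≤ n → ∣ S n - S P ∣ < ½ * ε
      close n P≤n = ℚ.≤-<-trans
        (ℚ.≤-trans (p≤p+q ∣ S n - S P ∣ (0≤t n))
          (subst (λ z → ∣ S z - S P ∣ + t z ≤ t P)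
            (ℕ.m∸n+n≡m P≤n) (tail P (ℕ.m≤n+m M (proj₁ small)) (n ℕ.∸ P))))
        (proj₂ small)
      rearrange : ∀ x y z → x - y ≡ (x - z) - (y - z)
      rearrange = solve 3 (λ x y z → x :- y := (x :- z) :- (y :- z)) refl
        where open +-*-Solver

open ExpEstimates using (expSum-cauchy)

exp : ℚ → ℝ
exp q = record { seq = expSum q ; cauchy = expSum-cauchy q }

ℚ⟦x⟧ ℝ⟦x⟧ : RawSemiring 0ℓ 0ℓ
ℚ⟦x⟧ = Series.rawSemiring ℚ.+-*-rawSemiring
ℝ⟦x⟧ = Series.rawSemiring ℝ-rawSemiring

open RawSemiring ℝ-rawSemiring public using ()
  renaming (_*_ to _*ʳ_)

open RawSemiring ℝ⟦x⟧ public using ()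
  renaming (_≈_ to _≋_; _*_ to _⊛_; 0# to 0ˢ)

open RawSemiring ℚ⟦x⟧ public using ()
  renaming (_+_ to _⊕_; 1# to 1ˢ)

open RawSemiringDefinitions ℚ⟦x⟧ public using ()
  renaming (_^_ to _^ˢ_)

infix  8 ⊖_
infixr 7 _•_

⊖_ : (ℕ → ℚ) → (ℕ → ℚ)
(⊖ f) n = - f n

X : ℕ → ℚ
X 0             = 0ℚ
X 1             = 1ℚ
X (suc (suc _)) = 0ℚ

eˣ : ℕ → ℚ
eˣ = 1/_!

embed : (ℕ → ℚ) → (ℕ → ℝ)
embed f n = ι (f n)

_•_ : ℚ → (ℕ → ℝ) → (ℕ → ℝ)
(q • f) n = ι q *ʳ f n

∫ : (ℕ → ℝ) → (ℕ → ℝ)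
∫ f zero    = ι 0ℚ
∫ f (suc n) = ι (+ 1 / suc n) *ʳ f n

dropConstant : (ℕ → ℚ) → (ℕ → ℚ)
dropConstant f zero    = 0ℚ
dropConstant f (suc n) = f (suc n)

-- e^f = e^{f(0)} · Σ_k (f - f(0))ᵏ / k!.  Since (f - f(0))ᵏ is divisible by
-- xᵏ, only the terms with k ≤ n contribute to the coefficient of xⁿ.  The
-- scalar e^{f(0)} is a real number, in general not rational.

Exp : (ℕ → ℚ) → (ℕ → ℝ)
Exp f n = exp (f 0) *ʳ
  ι (sum {suc n} λ i → 1/ toℕ i ! * (dropConstant f ^ˢ toℕ i) n)

E : ∀ {k} → Vec ℕ k → (ℕ → ℝ)
E p = embed λ n → (+ N p n / (n !)) {{n !≢0}}

{-# OPTIONS --safe #-}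
module Submission where

-- Let m be the largest letter of π = l m r.  A letter of r is smaller than m,
-- so it is not the top of a descent if π avoids 3-21; hence π avoids 3-21 iff
-- l does and r is increasing.  Moreover π begins with (k-1)⋯1k iff l does or l
-- is (k-1)⋯1, which avoids 3-21 only for k ≤ 3.  Choosing the letters of l
-- gives y′ = eˣ y + eˣ xᵏ⁻¹/(k-1)! for the generating function y of the nonempty
-- permutations, and e^(eˣ) ∫ eᵗ tᵏ⁻¹/(k-1)! e^(-eᵗ) solves this equation.
-- All series are e or 1/e times rational ones, so the reals only enter through
-- e · 1/e = 1: the m-th approximants of both sides differ by the factor P Q,
-- where P and Q are the partial sums of length m of e and of 1/e.

open import Defs
open import Data.Fin.Base as Fin using (Fin; zero; suc; toℕ)
open import Data.Nat.Base as ℕ using (ℕ; zero; suc; _!; z≤n; s≤s; _≤_; _∸_)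
import Data.Nat.Properties as ℕ
open import Data.Product.Base using (∃; _×_; _,_; proj₁; proj₂)
open import Data.Sum.Base using (_⊎_; inj₁; inj₂)
open import Data.Vec.Base using (Vec)
open import Function.Base using (_∘_)
open import Relation.Binary.PropositionalEquality hiding ([_])

-- The recursion cannot stay within permutations of an initial segment, because `l` uses an
-- arbitrary subset of the letters. It therefore runs on words over any finite set of letters, and
-- the count turns out to depend only on the size of the set. The identities between exponentials of
-- series come from uniqueness for linear equations: both sides solve the same y′ = g y + c and have
-- the same constant term. For the limit of P Q, the error P(n) Q(n) - 1 is the sum of (1/i!) (Q(n)
-- - Q(n-i)). The remainder Q(n) - Q(m) is at most 1/m! in absolute value, so the error is at most
-- the sum of 1/i! · 1/(n-i)!, which is 2ⁿ/n! and tends to 0.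

module Counting where

  open import Data.Fin.Base using (fromℕ<)
  import Data.Fin.Properties as Fin
  open import Data.Empty using (⊥)
  open import Data.List.Base
    using (List; []; _∷_; [_]; _++_; map; length; filter; reverse; concatMap; downFrom)
  import Data.List.Properties as List
  open import Data.List.Membership.Propositional using (_∈_; _∉_)
  open import Data.List.Membership.Propositional.Properties
  open import Data.List.Membership.Propositional.Properties.WithK using (unique∧set⇒bag)
  open import Data.List.Relation.Binary.BagAndSetEquality using (∼bag⇒↭)
  open import Data.List.Relation.Binary.Disjoint.Propositional using (Disjoint)
  open import Data.List.Relation.Binary.Permutation.Propositional
    using (_↭_; ↭-sym; ↭-trans; ↭-refl; prep; ↭⇒↭ₛ)
  import Data.List.Relation.Binary.Permutation.Propositional.Properties as ↭
  import Data.List.Relation.Binary.Permutation.Setoid.Properties as ↭ₛ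
  open import Data.List.Relation.Unary.All as All using (All; []; _∷_)
  import Data.List.Relation.Unary.All.Properties as All
  open import Data.List.Relation.Unary.AllPairs as AllPairs using (AllPairs; []; _∷_)
  import Data.List.Relation.Unary.AllPairs.Properties as AllPairs
  open import Data.List.Relation.Unary.Any using (here; there)
  open import Data.List.Relation.Unary.Unique.Propositional using (Unique)
  import Data.List.Relation.Unary.Unique.Propositional.Properties as Unique
  open import Data.Nat.Base
  open import Data.Nat.ListAction using (sum)
  open import Data.Nat.ListAction.Properties using (sum-++)
  open import Data.Nat.Properties
  open import Data.Product.Base using (Σ; ∃₂; map₁; map₂)
  open import Data.Unit.Base using (⊤; tt)
  open import Data.Vec.Base as Vec using ([]; _∷_; lookup; truncate)
  import Data.Vec.Relation.Unary.All as Vec using (All; []; _∷_)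
  import Data.Vec.Relation.Unary.AllPairs as Vec using ([]; _∷_)
  import Data.Vec.Relation.Unary.Unique.Propositional as Vec using (Unique)
  open import Function.Base using (id; flip)
  open import Function.Bundles using (mk⇔; _⇔_; Equivalence)
  open import Relation.Binary.Core using (Rel)
  open import Relation.Binary.Definitions using (Asymmetric)
  open import Relation.Nullary using (¬_; contradiction)

  -- Avoidance and beginnings of a word split at its largest letter

  -- p is the largest letter to the left of the word, or 0 at the beginning.
  Avoids : ℕ → List ℕ → Set
  Avoids p []          = ⊤
  Avoids p (_ ∷ [])    = ⊤
  Avoids p (x ∷ y ∷ w) = (y < x → p ≤ x) × Avoids (p ⊔ x) (y ∷ w)

  -- The pattern is (k-1)⋯1k with j = k - 1; unlike in BeginsWith, the empty
  -- word does not begin with 1.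
  Begins : ℕ → List ℕ → Set
  Begins 0 (_ ∷ _)         = ⊤
  Begins 1 (x ∷ y ∷ _)     = x < y
  Begins 2 (x ∷ y ∷ z ∷ _) = y < x × x < z
  Begins _ _               = ⊥

  -- The order type (k-1)⋯1 of the letters before the k, when the k of the pattern
  -- is the largest letter of the word; it is 3-21-free only for j ≤ 2.
  Start : ℕ → List ℕ → Set
  Start 0 []          = ⊤
  Start 1 (_ ∷ [])    = ⊤
  Start 2 (x ∷ y ∷ []) = y < x
  Start _ _           = ⊥

  -- If `l` is too short to contain the whole prefix, then `m` is one of the prefix letters. Being
  -- larger than its neighbours on both sides, it can only play the role of the final k.
  Begins-++⁻ : ∀ j {m} l {r} → All (_< m) l → All (_< m) r →
    Begins j (l ++ m ∷ r) → Begins j l ⊎ Start j l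
  Begins-++⁻ 0 []                      _         _             _         = inj₂ tt
  Begins-++⁻ 0 (_ ∷ _)                 _         _             _         = inj₁ tt
  Begins-++⁻ 1 []          {_ ∷ _}     _         (x<m ∷ _)     m<x       = contradiction m<x (<-asym x<m)
  Begins-++⁻ 1 (_ ∷ [])                _         _             _         = inj₂ tt
  Begins-++⁻ 1 (_ ∷ _ ∷ _)             _         _             b         = inj₁ b
  Begins-++⁻ 2 []          {_ ∷ _ ∷ _} _         (_ ∷ y<m ∷ _) (_ , m<y) = contradiction m<y (<-asym y<m)
  Begins-++⁻ 2 (_ ∷ [])    {_ ∷ _}     (x<m ∷ _) _             (m<x , _) = contradiction m<x (<-asym x<m)
  Begins-++⁻ 2 (_ ∷ _ ∷ [])            _         _             (y<x , _) = inj₂ y<x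
  Begins-++⁻ 2 (_ ∷ _ ∷ _ ∷ _)         _         _             b         = inj₁ b

  Begins-++⁺ : ∀ j {m} l r → All (_< m) l → Begins j l ⊎ Start j l → Begins j (l ++ m ∷ r)
  Begins-++⁺ 0 []              r _         _          = tt
  Begins-++⁺ 0 (_ ∷ _)         r _         _          = tt
  Begins-++⁺ 1 (_ ∷ [])        r (x<m ∷ _) _          = x<m
  Begins-++⁺ 1 (_ ∷ _ ∷ _)     r _         (inj₁ b)   = b
  Begins-++⁺ 1 (_ ∷ _ ∷ _)     r _         (inj₂ ())
  Begins-++⁺ 1 []              r _         (inj₁ ())
  Begins-++⁺ 1 []              r _         (inj₂ ())
  Begins-++⁺ 2 (_ ∷ _ ∷ [])    r (x<m ∷ _) (inj₂ y<x) = y<x , x<m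
  Begins-++⁺ 2 (_ ∷ _ ∷ _ ∷ _) r _         (inj₁ b)   = b
  Begins-++⁺ 2 (_ ∷ _ ∷ _ ∷ _) r _         (inj₂ ())
  Begins-++⁺ 2 []              r _         (inj₁ ())
  Begins-++⁺ 2 []              r _         (inj₂ ())
  Begins-++⁺ 2 (_ ∷ [])        r _         (inj₁ ())
  Begins-++⁺ 2 (_ ∷ [])        r _         (inj₂ ())
  Begins-++⁺ (suc (suc (suc _))) _ r _     (inj₁ ())
  Begins-++⁺ (suc (suc (suc _))) _ r _     (inj₂ ())

  Start⇒Avoids : ∀ j l → Start j l → Avoids 0 l
  Start⇒Avoids 0 []           _ = tt
  Start⇒Avoids 1 (_ ∷ [])     _ = tt
  Start⇒Avoids 2 (_ ∷ _ ∷ []) _ = (λ _ → z≤n) , tt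

  Begins⇒¬Start : ∀ j l → Begins j l → ¬ Start j l
  Begins⇒¬Start 0 (_ ∷ _)         _ ()
  Begins⇒¬Start 1 (_ ∷ _ ∷ _)     _ ()
  Begins⇒¬Start 2 (_ ∷ _ ∷ _ ∷ _) _ ()

  increasing⇒Avoids : ∀ p {w} → AllPairs _<_ w → Avoids p w
  increasing⇒Avoids p []                                  = tt
  increasing⇒Avoids p (_ ∷ [])                            = tt
  increasing⇒Avoids p {x ∷ _} ((x<y ∷ _) ∷ w↑@(_ ∷ _)) =
    (λ y<x → contradiction x<y (<-asym y<x)) , increasing⇒Avoids (p ⊔ x) w↑

  -- As `p` stands to the left and exceeds every letter of `w`, it would be the 3 over any descent,
  -- so there is none. The running maximum remains `p` throughout.
  Avoids⇒increasing : ∀ p {w} → All (_< p) w → Unique w → Avoids p w → AllPairs _<_ w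
  Avoids⇒increasing p []                  _              _       = []
  Avoids⇒increasing p (_ ∷ [])            _              _       = [] ∷ []
  Avoids⇒increasing p {x ∷ y ∷ w} (x<p ∷ w<p@(_ ∷ _)) ((x≢y ∷ _) ∷ w!) (h , a)
    with Avoids⇒increasing p w<p w! (subst (λ q → Avoids q (y ∷ w)) (m≥n⇒m⊔n≡m (<⇒≤ x<p)) a)
  ... | w↑@(y<w ∷ _) = (x<y ∷ All.map (<-trans x<y) y<w) ∷ w↑
    where
    x<y : x < y
    x<y = ≤∧≢⇒< (≮⇒≥ λ y<x → <⇒≱ x<p (h y<x)) x≢y

  -- The invariant `p ≤ m` makes `m` harmless as the top of a descent, and the letter just before
  -- `m` is not a descent top at all.
  Avoids-++⁺ : ∀ {p m} l {r} → p ≤ m → All (_< m) l → All (_< m) r →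
    Avoids p l → AllPairs _<_ r → Avoids p (l ++ m ∷ r)
  Avoids-++⁺ []          {[]}    p≤m _           _   _       _  = tt
  Avoids-++⁺ []          {_ ∷ _} p≤m _           _   _       r↑ =
    (λ _ → p≤m) , increasing⇒Avoids _ r↑
  Avoids-++⁺ (x ∷ [])            p≤m (x<m ∷ _)   r<m _       r↑ =
    (λ m<x → contradiction m<x (<-asym x<m)) ,
    Avoids-++⁺ [] (⊔-lub p≤m (<⇒≤ x<m)) [] r<m tt r↑
  Avoids-++⁺ (x ∷ y ∷ l)         p≤m (x<m ∷ l<m) r<m (h , a) r↑ =
    h , Avoids-++⁺ (y ∷ l) (⊔-lub p≤m (<⇒≤ x<m)) l<m r<m a r↑

  Avoids-++⁻ : ∀ {p m} l {r} → p ≤ m → All (_< m) l → All (_< m) r → Unique r →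
    Avoids p (l ++ m ∷ r) → Avoids p l × AllPairs _<_ r
  Avoids-++⁻ []          {[]}    p≤m _           _   _  _       = tt , []
  Avoids-++⁻ []          {y ∷ r} p≤m _           r<m r! (_ , a) = tt ,
    Avoids⇒increasing _ r<m r! (subst (λ q → Avoids q (y ∷ r)) (m≤n⇒m⊔n≡n p≤m) a)
  Avoids-++⁻ (x ∷ [])            p≤m (x<m ∷ _)   r<m r! (_ , a) =
    tt , proj₂ (Avoids-++⁻ [] (⊔-lub p≤m (<⇒≤ x<m)) [] r<m r! a)
  Avoids-++⁻ (x ∷ y ∷ l)         p≤m (x<m ∷ l<m) r<m r! (h , a) =
    let al , r↑ = Avoids-++⁻ (y ∷ l) (⊔-lub p≤m (<⇒≤ x<m)) l<m r<m r! a in (h , al) , r↑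

  -- Finite sets of letters as decreasing lists, and their splittings

  Decreasing : List ℕ → Set
  Decreasing = AllPairs _>_

  -- If the heads differed, each would be a later member of the other list, hence related to the
  -- other head in both directions, against asymmetry.
  sorted-unique : ∀ {a ℓ} {A : Set a} {_∼_ : Rel A ℓ} → Asymmetric _∼_ → ∀ {xs ys} →
    AllPairs _∼_ xs → AllPairs _∼_ ys → xs ↭ ys → xs ≡ ys
  sorted-unique asym []      _  xs↭ys = sym (↭.↭-empty-inv (↭-sym xs↭ys))
  sorted-unique asym (_ ∷ _) [] xs↭ys = contradiction xs↭ys ↭.¬x∷xs↭[]
  sorted-unique asym {x ∷ xs} {y ∷ ys} (x∼xs ∷ xs∼) (y∼ys ∷ ys∼) xs↭ys
    with ↭.∈-resp-↭ xs↭ys (here refl) | ↭.∈-resp-↭ (↭-sym xs↭ys) (here refl)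
  ... | here refl  | _          = cong (x ∷_) (sorted-unique asym xs∼ ys∼ (↭.drop-∷ xs↭ys))
  ... | there _    | here refl  = cong (x ∷_) (sorted-unique asym xs∼ ys∼ (↭.drop-∷ xs↭ys))
  ... | there x∈ys | there y∈xs =
    contradiction (All.lookup y∼ys x∈ys) (asym (All.lookup x∼xs y∈xs))

  reverse-sorted : ∀ {a ℓ} {A : Set a} {_∼_ : Rel A ℓ} {xs} →
    AllPairs _∼_ xs → AllPairs (flip _∼_) (reverse xs)
  reverse-sorted []                         = []
  reverse-sorted {xs = x ∷ xs} (x∼xs ∷ xs∼) =
    subst (AllPairs _) (sym (List.unfold-reverse x xs))
      (AllPairs.++⁺ (reverse-sorted xs∼) ([] ∷ [])
        (All.map (λ x∼y → x∼y ∷ []) (↭.All-resp-↭ (↭-sym (↭.↭-reverse xs)) x∼xs)))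

  splits : ∀ {a} {A : Set a} → List A → List (List A × List A)
  splits []       = [ [] , [] ]
  splits (x ∷ xs) = map (map₁ (x ∷_)) (splits xs) ++ map (map₂ (x ∷_)) (splits xs)

  -- Decreasing lists are canonical representatives of sets: the head is the largest letter, and
  -- lists with the same letters are equal. A split is thus a choice of the set of letters of the
  -- left part.
  IsSplit : List ℕ → List ℕ × List ℕ → Set
  IsSplit S (L , R) = L ++ R ↭ S × Decreasing L × Decreasing R

  splits-sound : ∀ {S} → Decreasing S → All (IsSplit S) (splits S)
  splits-sound []                 = (↭-refl , [] , []) ∷ []
  splits-sound {x ∷ S} (x>S ∷ S↓) = All.++⁺
    (All.map⁺ (All.map (λ { {L , R} (p , L↓ , R↓) →
      prep x p , All.++⁻ˡ L (↭.All-resp-↭ (↭-sym p) x>S) ∷ L↓ , R↓ }) ih))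
    (All.map⁺ (All.map (λ { {L , R} (p , L↓ , R↓) →
      ↭-trans (↭.shift x L R) (prep x p) , L↓ , All.++⁻ʳ L (↭.All-resp-↭ (↭-sym p) x>S) ∷ R↓ }) ih))
    where ih = splits-sound S↓

  splits-complete : ∀ S l r → l ++ r ↭ S →
    ∃₂ λ (L R : List ℕ) → (L , R) ∈ splits S × l ↭ L × r ↭ R
  splits-complete [] [] [] p = [] , [] , here refl , ↭-refl , ↭-refl
  splits-complete [] [] (_ ∷ _) p = contradiction p ↭.¬x∷xs↭[]
  splits-complete [] (_ ∷ _) _  p = contradiction p ↭.¬x∷xs↭[]
  splits-complete (x ∷ S) l r p with ∈-++⁻ l (↭.∈-resp-↭ (↭-sym p) (here refl))
  ... | inj₁ x∈l with l₁ , l₂ , refl ← ∈-∃++ x∈l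
    with L , R , s , l↭L , r↭R ← splits-complete S (l₁ ++ l₂) r
      (subst (_↭ S) (sym (List.++-assoc l₁ l₂ r))
        (↭.drop-mid l₁ [] (subst (_↭ x ∷ S) (List.++-assoc l₁ (x ∷ l₂) r) p)))
    = x ∷ L , R , ∈-++⁺ˡ (∈-map⁺ _ s) , ↭-trans (↭.shift x l₁ l₂) (prep x l↭L) , r↭R
  splits-complete (x ∷ S) l r p | inj₂ x∈r with r₁ , r₂ , refl ← ∈-∃++ x∈r
    with L , R , s , l↭L , r↭R ← splits-complete S l (r₁ ++ r₂)
      (subst (_↭ S) (List.++-assoc l r₁ r₂)
        (↭.drop-mid (l ++ r₁) [] (subst (_↭ x ∷ S) (sym (List.++-assoc l r₁ (x ∷ r₂))) p)))
    = L , x ∷ R , ∈-++⁺ʳ (map (map₁ (x ∷_)) (splits S)) (∈-map⁺ _ s) , l↭L ,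
      ↭-trans (↭.shift x r₁ r₂) (prep x r↭R)

  -- The second components are compared because they remain visible in a generated word, as the
  -- suffix after its largest letter. Across the two halves they differ since only those of the
  -- second half contain `x`.
  splits-distinct : ∀ {S} → Decreasing S → AllPairs (λ s t → proj₂ s ≢ proj₂ t) (splits S)
  splits-distinct []                 = [] ∷ []
  splits-distinct {x ∷ S} (x>S ∷ S↓) = AllPairs.++⁺
    (AllPairs.map⁺ ih)
    (AllPairs.map⁺ (AllPairs.map (λ ne eq → ne (List.∷-injectiveʳ eq)) ih))
    (All.map⁺ (All.map (λ { {L , R} (p , _) → All.map⁺ (All.universal (λ t eq →
       <-irrefl refl (All.lookup x>S (↭.∈-resp-↭ p (∈-++⁺ʳ L (subst (x ∈_) (sym eq) (here refl))))))
       (splits S)) }) (splits-sound S↓)))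
    where ih = splits-distinct S↓

  -- Exhaustive generation of the words without repetition

  start : ℕ → List ℕ → List (List ℕ)
  start 0 []           = [ [] ]
  start 1 (x ∷ [])     = [ x ∷ [] ]
  start 2 (x ∷ y ∷ []) = [ x ∷ y ∷ [] ]
  start _ _            = []

  -- The word required by `Start` is decreasing, and the only decreasing arrangement of the letters
  -- of `L` is `L` itself.
  start-sound : ∀ j L → Decreasing L → ∀ {l} → l ∈ start j L → Start j l × l ≡ L
  start-sound 0 []           _               (here refl) = tt , refl
  start-sound 1 (_ ∷ [])     _               (here refl) = tt , refl
  start-sound 2 (_ ∷ _ ∷ []) ((x>y ∷ _) ∷ _) (here refl) = x>y , refl

  Start⇒Decreasing : ∀ j l → Start j l → Decreasing l
  Start⇒Decreasing 0 []           _   = []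
  Start⇒Decreasing 1 (_ ∷ [])     _   = [] ∷ []
  Start⇒Decreasing 2 (_ ∷ _ ∷ []) y<x = (y<x ∷ []) ∷ [] ∷ []

  start-complete : ∀ j l → Start j l → l ∈ start j l
  start-complete 0 []           _ = here refl
  start-complete 1 (_ ∷ [])     _ = here refl
  start-complete 2 (_ ∷ _ ∷ []) _ = here refl

  start-unique : ∀ j L → Unique (start j L)
  start-unique 0 []                    = [] ∷ []
  start-unique 0 (_ ∷ _)               = []
  start-unique 1 []                    = []
  start-unique 1 (_ ∷ [])              = [] ∷ []
  start-unique 1 (_ ∷ _ ∷ _)           = []
  start-unique 2 []                    = []
  start-unique 2 (_ ∷ [])              = []
  start-unique 2 (_ ∷ _ ∷ [])          = [] ∷ []
  start-unique 2 (_ ∷ _ ∷ _ ∷ _)       = []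
  start-unique (suc (suc (suc _))) _   = []

  -- Kronecker's delta for j ≤ 2, but 0 for larger j.
  δ : ℕ → ℕ → ℕ
  δ 0 0 = 1
  δ 1 1 = 1
  δ 2 2 = 1
  δ _ _ = 0

  length-start : ∀ j L → length (start j L) ≡ δ j (length L)
  length-start 0 []                  = refl
  length-start 0 (_ ∷ _)             = refl
  length-start 1 []                  = refl
  length-start 1 (_ ∷ [])            = refl
  length-start 1 (_ ∷ _ ∷ _)         = refl
  length-start 2 []                  = refl
  length-start 2 (_ ∷ [])            = refl
  length-start 2 (_ ∷ _ ∷ [])        = refl
  length-start 2 (_ ∷ _ ∷ _ ∷ _)     = refl
  length-start (suc (suc (suc _))) _ = refl

  -- Good j S, listed by the decomposition l m r at the largest letter m.  The
  -- second argument bounds the length of S and only serves termination.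
  mutual
    gen : ℕ → ℕ → List ℕ → List (List ℕ)
    gen j zero    _       = []
    gen j (suc k) []      = []
    gen j (suc k) (m ∷ S) = concatMap (extend j k m) (splits S)

    extend : ℕ → ℕ → ℕ → List ℕ × List ℕ → List (List ℕ)
    extend j k m (L , R) = map (_++ m ∷ reverse R) (gen j k L ++ start j L)

  Good : ℕ → List ℕ → List ℕ → Set
  Good j S w = Avoids 0 w × Begins j w × w ↭ S

  mutual
    gen-sound : ∀ j k {S} → Decreasing S → ∀ {w} → w ∈ gen j k S → Good j S w
    gen-sound j (suc k) {m ∷ S} (m>S ∷ S↓) w∈
      with _ , w∈s , s∈ ← ∈-concat⁻′ (map (extend j k m) (splits S)) w∈
      with (L , R) , s , refl ← ∈-map⁻ (extend j k m) s∈
      with p , L↓ , R↓ ← All.lookup (splits-sound S↓) s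
      with l , l∈ , refl ← ∈-map⁻ (_++ m ∷ reverse R) w∈s
      = let a , b , l↭L = part-sound j k L↓ l∈
            LR<m = ↭.All-resp-↭ (↭-sym p) m>S
            l<m = ↭.All-resp-↭ (↭-sym l↭L) (All.++⁻ˡ L LR<m)
            r<m = ↭.All-resp-↭ (↭-sym (↭.↭-reverse R)) (All.++⁻ʳ L LR<m)
        in Avoids-++⁺ l z≤n l<m r<m a (reverse-sorted R↓)
         , Begins-++⁺ j l (reverse R) l<m b
         , ↭-trans (↭.shift m l (reverse R)) (prep m (↭-trans (↭.++⁺ l↭L (↭.↭-reverse R)) p))

    part-sound : ∀ j k {L} → Decreasing L → ∀ {l} → l ∈ gen j k L ++ start j L →
      Avoids 0 l × (Begins j l ⊎ Start j l) × l ↭ L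
    part-sound j k {L} L↓ {l} l∈ with ∈-++⁻ (gen j k L) l∈
    ... | inj₁ l∈gen   = let a , b , p = gen-sound j k L↓ l∈gen in a , inj₁ b , p
    ... | inj₂ l∈start = let s , l≡L = start-sound j L L↓ l∈start in
      Start⇒Avoids j l s , inj₂ s , subst (_↭ L) (sym l≡L) ↭-refl

  Decreasing⇒Unique : ∀ {S} → Decreasing S → Unique S
  Decreasing⇒Unique = AllPairs.map (λ x>y x≡y → <-irrefl (sym x≡y) x>y)

  Unique-resp-↭ : ∀ {xs ys : List ℕ} → xs ↭ ys → Unique xs → Unique ys
  Unique-resp-↭ p = ↭ₛ.Unique-resp-↭ (setoid ℕ) (↭⇒↭ₛ p)

  ¬Begins-[] : ∀ j → ¬ Begins j []
  ¬Begins-[] 0                   ()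
  ¬Begins-[] 1                   ()
  ¬Begins-[] 2                   ()
  ¬Begins-[] (suc (suc (suc _))) ()

  mutual
    gen-complete : ∀ j k {S} → length S ≤ k → Decreasing S → ∀ {w} → Good j S w → w ∈ gen j k S
    gen-complete j k {[]} _ _ (_ , b , p) =
      contradiction (subst (Begins j) (↭.↭-empty-inv p) b) (¬Begins-[] j)
    gen-complete j (suc k) {m ∷ S} (s≤s S≤k) (m>S ∷ S↓) {w} (a , b , p)
      with l , r , refl ← ∈-∃++ (↭.∈-resp-↭ (↭-sym p) (here refl))
      with lr↭S ← ↭.drop-mid l [] p
      with L , R , s , l↭L , r↭R ← splits-complete S l r lr↭S
      with LR↭S , L↓ , R↓ ← All.lookup (splits-sound S↓) s
      = subst (λ r → l ++ m ∷ r ∈ gen j (suc k) (m ∷ S)) (sym r≡)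
          (∈-concat⁺′ (∈-map⁺ (_++ m ∷ reverse R)
              (part-complete j k (≤-trans L≤S S≤k) L↓ al (Begins-++⁻ j l l<m r<m b) l↭L))
            (∈-map⁺ (extend j k m) s))
      where
      lr<m = ↭.All-resp-↭ (↭-sym lr↭S) m>S
      l<m = All.++⁻ˡ l lr<m
      r<m = All.++⁻ʳ l lr<m
      r! = Unique-resp-↭ (↭-sym r↭R) (Decreasing⇒Unique R↓)
      al = proj₁ (Avoids-++⁻ l z≤n l<m r<m r! a)
      r↑ = proj₂ (Avoids-++⁻ l z≤n l<m r<m r! a)
      -- `r` is increasing and has the letters of `R`, so the split determines it completely; only
      -- the arrangement of `l` is left to the recursion.
      r≡ : r ≡ reverse R
      r≡ = sorted-unique <-asym r↑ (reverse-sorted R↓) (↭-trans r↭R (↭-sym (↭.↭-reverse R)))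
      L≤S : length L ≤ length S
      L≤S = ≤-trans (m≤m+n (length L) (length R))
        (≤-reflexive (trans (sym (List.length-++ L)) (↭.↭-length LR↭S)))

    part-complete : ∀ j k {L} → length L ≤ k → Decreasing L → ∀ {l} →
      Avoids 0 l → Begins j l ⊎ Start j l → l ↭ L → l ∈ gen j k L ++ start j L
    part-complete j k L≤k L↓ a (inj₁ b) p = ∈-++⁺ˡ (gen-complete j k L≤k L↓ (a , b , p))
    part-complete j k {L} L≤k L↓ {l} a (inj₂ s) p = ∈-++⁺ʳ (gen j k L)
      (subst (λ L → l ∈ start j L)
        (sorted-unique (λ x>y y>x → <-asym x>y y>x) (Start⇒Decreasing j l s) L↓ p)
        (start-complete j l s))

  -- Both displayed occurrences of `m` are the first one in the same word, so they stand at the same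
  -- position.
  suffix-unique : ∀ {a} {A : Set a} {m : A} l l′ {r r′} → m ∉ l → m ∉ l′ →
    l ++ m ∷ r ≡ l′ ++ m ∷ r′ → r ≡ r′
  suffix-unique []      []       _   _    eq = List.∷-injectiveʳ eq
  suffix-unique []      (x ∷ l′) _   m∉l′ eq = contradiction (here (List.∷-injectiveˡ eq)) m∉l′
  suffix-unique (x ∷ l) []       m∉l _    eq = contradiction (here (sym (List.∷-injectiveˡ eq))) m∉l
  suffix-unique (x ∷ l) (y ∷ l′) m∉l m∉l′ eq =
    suffix-unique l l′ (m∉l ∘ there) (m∉l′ ∘ there) (List.∷-injectiveʳ eq)

  -- Three sources of repetition are excluded: appending a fixed suffix is injective, `gen` and
  -- `start` are disjoint by `Begins⇒¬Start`, and words from different splits differ after `m`.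
  gen-unique : ∀ j k {S} → Decreasing S → Unique (gen j k S)
  gen-unique j zero            _          = []
  gen-unique j (suc k) {[]}    _          = []
  gen-unique j (suc k) {m ∷ S} (m>S ∷ S↓) = Unique.concat⁺
    (All.map⁺ (All.map (λ { {L , R} (_ , L↓ , _) → Unique.map⁺ (List.++-cancelʳ (m ∷ reverse R) _ _)
      (Unique.++⁺ (gen-unique j k L↓) (start-unique j L) λ (l∈gen , l∈start) →
        Begins⇒¬Start j _ (proj₁ (proj₂ (gen-sound j k L↓ l∈gen))) (proj₁ (start-sound j L L↓ l∈start))) })
      sound))
    (AllPairs.map⁺ (distinct⇒disjoint sound (splits-distinct S↓)))
    where
    sound = splits-sound S↓

    m∉ : ∀ {L R} → IsSplit S (L , R) → ∀ {l} → l ∈ gen j k L ++ start j L → m ∉ l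
    m∉ {L} (p , L↓ , _) l∈ m∈l = <-irrefl refl (All.lookup m>S (↭.∈-resp-↭ p
      (∈-++⁺ˡ (↭.∈-resp-↭ (proj₂ (proj₂ (part-sound j k L↓ l∈))) m∈l))))

    disjoint : ∀ {s t} → IsSplit S s → IsSplit S t → proj₂ s ≢ proj₂ t →
      Disjoint (extend j k m s) (extend j k m t)
    disjoint {L , R} {L′ , R′} sp sp′ R≢R′ (w∈ , w∈′)
      with l , l∈ , refl ← ∈-map⁻ (_++ m ∷ reverse R) w∈
      with l′ , l′∈ , eq ← ∈-map⁻ (_++ m ∷ reverse R′) w∈′
      = R≢R′ (List.reverse-injective (suffix-unique l l′ (m∉ sp l∈) (m∉ sp′ l′∈) eq))

    distinct⇒disjoint : ∀ {ss} → All (IsSplit S) ss → AllPairs (λ s t → proj₂ s ≢ proj₂ t) ss →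
      AllPairs (λ s t → Disjoint (extend j k m s) (extend j k m t)) ss
    distinct⇒disjoint []         []         = []
    distinct⇒disjoint (sp ∷ sps) (s≢ ∷ ss≢) =
      All.zipWith (λ (sp′ , s≢t) {v} → disjoint sp sp′ s≢t {v}) (sps , s≢) ∷ distinct⇒disjoint sps ss≢

  -- Sizes of the generated lists

  -- Σᵢ C(n,i) f(i), by Pascal's rule.
  binom : (ℕ → ℕ) → ℕ → ℕ
  binom f zero    = f 0
  binom f (suc n) = binom (f ∘ suc) n + binom f n

  binom-cong : ∀ {f g} n → (∀ i → i ≤ n → f i ≡ g i) → binom f n ≡ binom g n
  binom-cong zero    f≡g = f≡g 0 z≤n
  binom-cong (suc n) f≡g = cong₂ _+_ (binom-cong n λ i i≤n → f≡g (suc i) (s≤s i≤n))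
    (binom-cong n λ i i≤n → f≡g i (m≤n⇒m≤1+n i≤n))

  -- The two halves of `splits` are the two summands of Pascal's rule: `x` going left replaces `f`
  -- by `f ∘ suc`, and `x` going right leaves `f` as it is.
  sum-splits : ∀ {a} {A : Set a} (f : ℕ → ℕ) (S : List A) →
    sum (map (f ∘ length ∘ proj₁) (splits S)) ≡ binom f (length S)
  sum-splits f []      = +-identityʳ (f 0)
  sum-splits f (x ∷ S) = begin
    sum (map g (map (map₁ (x ∷_)) (splits S) ++ map (map₂ (x ∷_)) (splits S)))
      ≡⟨ cong sum (List.map-++ g (map (map₁ (x ∷_)) (splits S)) _) ⟩
    sum (map g (map (map₁ (x ∷_)) (splits S)) ++ map g (map (map₂ (x ∷_)) (splits S)))
      ≡⟨ sum-++ (map g (map (map₁ (x ∷_)) (splits S))) _ ⟩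
    sum (map g (map (map₁ (x ∷_)) (splits S))) + sum (map g (map (map₂ (x ∷_)) (splits S)))
      ≡⟨ cong₂ (λ a b → sum a + sum b) (List.map-∘ (splits S)) (List.map-∘ (splits S)) ⟨
    sum (map (f ∘ suc ∘ length ∘ proj₁) (splits S)) + sum (map g (splits S))
      ≡⟨ cong₂ _+_ (sum-splits (f ∘ suc) S) (sum-splits f S) ⟩
    binom (f ∘ suc) (length S) + binom f (length S) ∎
    where
    open ≡-Reasoning
    g = f ∘ length ∘ proj₁

  length-concatMap : ∀ {a b} {A : Set a} {B : Set b} (f : A → List B) xs →
    length (concatMap f xs) ≡ sum (map (length ∘ f) xs)
  length-concatMap f []       = refl
  length-concatMap f (x ∷ xs) = trans (List.length-++ (f x))
    (cong (length (f x) +_) (length-concatMap f xs))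

  -- The fuel `k` mirrors that of `gen`, so that `length-gen` follows the same recursion;
  -- `count-stable` then makes the value independent of it.
  count : ℕ → ℕ → ℕ → ℕ
  count j zero    n       = 0
  count j (suc k) zero    = 0
  count j (suc k) (suc n) = binom (λ i → count j k i + δ j i) n

  length-gen : ∀ j k S → length (gen j k S) ≡ count j k (length S)
  length-gen j zero    S       = refl
  length-gen j (suc k) []      = refl
  length-gen j (suc k) (m ∷ S) = begin
    length (concatMap (extend j k m) (splits S))
      ≡⟨ length-concatMap (extend j k m) (splits S) ⟩
    sum (map (length ∘ extend j k m) (splits S))
      ≡⟨ cong sum (List.map-cong (λ (L , R) → begin
           length (map (_++ m ∷ reverse R) (gen j k L ++ start j L))
             ≡⟨ List.length-map (_++ m ∷ reverse R) (gen j k L ++ start j L) ⟩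
           length (gen j k L ++ start j L)
             ≡⟨ List.length-++ (gen j k L) ⟩
           length (gen j k L) + length (start j L)
             ≡⟨ cong₂ _+_ (length-gen j k L) (length-start j L) ⟩
           count j k (length L) + δ j (length L) ∎) (splits S)) ⟩
    sum (map (λ s → count j k (length (proj₁ s)) + δ j (length (proj₁ s))) (splits S))
      ≡⟨ sum-splits (λ i → count j k i + δ j i) S ⟩
    binom (λ i → count j k i + δ j i) (length S) ∎
    where open ≡-Reasoning

  count-stable : ∀ j {k k′} n → n ≤ k → n ≤ k′ → count j k n ≡ count j k′ n
  count-stable j {zero}  {zero}  zero    _         _          = refl
  count-stable j {zero}  {suc _} zero    _         _          = refl
  count-stable j {suc _} {zero}  zero    _         _          = refl
  count-stable j {suc _} {suc _} zero    _         _          = refl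
  count-stable j {suc k} {suc _} (suc n) (s≤s n≤k) (s≤s n≤k′) = binom-cong n λ i i≤n →
    cong (_+ δ j i) (count-stable j i (≤-trans i≤n n≤k) (≤-trans i≤n n≤k′))

  -- Transfer from one-line notation to lists of letters

  letters : ∀ {n m} → Vec (Fin n) m → List ℕ
  letters []      = []
  letters (x ∷ π) = toℕ x ∷ letters π

  letters-injective : ∀ {n m} {π ρ : Vec (Fin n) m} → letters π ≡ letters ρ → π ≡ ρ
  letters-injective {π = []}    {[]}    _  = refl
  letters-injective {π = x ∷ π} {y ∷ ρ} eq =
    cong₂ _∷_ (Fin.toℕ-injective (List.∷-injectiveˡ eq)) (letters-injective (List.∷-injectiveʳ eq))

  letters-< : ∀ {n m} (π : Vec (Fin n) m) → All (_< n) (letters π)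
  letters-< []      = []
  letters-< (x ∷ π) = Fin.toℕ<n x ∷ letters-< π

  length-letters : ∀ {n m} (π : Vec (Fin n) m) → length (letters π) ≡ m
  length-letters []      = refl
  length-letters (x ∷ π) = cong suc (length-letters π)

  letters-surjective : ∀ {n m} w → All (_< n) w → length w ≡ m →
    ∃ λ (π : Vec (Fin n) m) → letters π ≡ w
  letters-surjective []      []          refl = [] , refl
  letters-surjective (x ∷ w) (x<n ∷ w<n) refl with π , eq ← letters-surjective w w<n refl =
    fromℕ< x<n ∷ π , cong₂ _∷_ (Fin.toℕ-fromℕ< x<n) eq

  letters-≢⁺ : ∀ {n m} x (π : Vec (Fin n) m) → Vec.All (x ≢_) π → All (toℕ x ≢_) (letters π)
  letters-≢⁺ x []      Vec.[]            = []
  letters-≢⁺ x (y ∷ π) (x≢y Vec.∷ x≢π) = x≢y ∘ Fin.toℕ-injective ∷ letters-≢⁺ x π x≢π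

  letters-≢⁻ : ∀ {n m} x (π : Vec (Fin n) m) → All (toℕ x ≢_) (letters π) → Vec.All (x ≢_) π
  letters-≢⁻ x []      []            = Vec.[]
  letters-≢⁻ x (y ∷ π) (x≢y ∷ x≢π) = x≢y ∘ cong toℕ Vec.∷ letters-≢⁻ x π x≢π

  letters-unique⁺ : ∀ {n m} {π : Vec (Fin n) m} → Vec.Unique π → Unique (letters π)
  letters-unique⁺ {π = []}    Vec.[]          = []
  letters-unique⁺ {π = x ∷ π} (x≢ Vec.∷ π!) = letters-≢⁺ x π x≢ ∷ letters-unique⁺ π!

  letters-unique⁻ : ∀ {n m} {π : Vec (Fin n) m} → Unique (letters π) → Vec.Unique π
  letters-unique⁻ {π = []}    []          = Vec.[]
  letters-unique⁻ {π = x ∷ π} (x≢ ∷ π!) = letters-≢⁻ x π x≢ Vec.∷ letters-unique⁻ π!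

  words-complete : ∀ {n m} (π : Vec (Fin n) m) → π ∈ words n m
  words-complete []      = here refl
  words-complete (x ∷ π) = ∈-cartesianProductWith⁺ _∷_ (∈-allFin x) (words-complete π)

  words-unique : ∀ n m → Unique (words n m)
  words-unique n zero    = [] ∷ []
  words-unique n (suc m) = Unique.cartesianProductWith⁺ _∷_ (λ { refl → refl , refl })
    (Unique.allFin⁺ n) (words-unique n m)

  -- A pigeonhole argument: `x` is removed from both lists, and distinctness keeps the rest of `xs`
  -- inside what remains of `ys`.
  unique-⊆⇒↭ : ∀ {a} {A : Set a} {xs ys : List A} → Unique xs → (∀ {x} → x ∈ xs → x ∈ ys) →
    length ys ≤ length xs → xs ↭ ys
  unique-⊆⇒↭ {xs = []}     {[]} _ _ _ = ↭-refl
  unique-⊆⇒↭ {xs = x ∷ xs} (x≢xs ∷ xs!) xs⊆ys |ys|≤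
    with a , b , refl ← ∈-∃++ (xs⊆ys (here refl)) =
    ↭-trans (prep x (unique-⊆⇒↭ xs! ⊆ab (s≤s⁻¹ (≤-trans (≤-reflexive (sym (↭.↭-length (↭.shift x a b)))) |ys|≤))))
      (↭-sym (↭.shift x a b))
    where
    ⊆ab : ∀ {z} → z ∈ xs → z ∈ a ++ b
    ⊆ab z∈xs with ↭.∈-resp-↭ (↭.shift x a b) (xs⊆ys (there z∈xs))
    ... | here z≡x   = contradiction (sym z≡x) (All.lookup x≢xs z∈xs)
    ... | there z∈ab = z∈ab

  downFrom-decreasing : ∀ n → Decreasing (downFrom n)
  downFrom-decreasing n = AllPairs.applyDownFrom⁺₁ id n (λ j<i _ → j<i)

  letters-↭ : ∀ {n} (π : Word n) → Vec.Unique π → letters π ↭ downFrom n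
  letters-↭ {n} π π! = unique-⊆⇒↭ (letters-unique⁺ π!)
    (λ x∈ → ∈-downFrom⁺ (All.lookup (letters-< π) x∈))
    (≤-reflexive (trans (List.length-downFrom n) (sym (length-letters π))))

  -- Avoidance in a positive form, for vectors whose length is independent of the alphabet, so that
  -- induction can pass to tails.
  321-free : ∀ {n m} → Vec (Fin n) m → Set
  321-free π = ∀ i j j⁺ → i Fin.< j → toℕ j⁺ ≡ suc (toℕ j) →
    lookup π j⁺ Fin.< lookup π j → lookup π i Fin.≤ lookup π j

  Avoids⇒≤ : ∀ {n m} p (π : Vec (Fin n) m) → Avoids p (letters π) → ∀ j j⁺ →
    toℕ j⁺ ≡ suc (toℕ j) → lookup π j⁺ Fin.< lookup π j → p ≤ toℕ (lookup π j)
  Avoids⇒≤ p (x ∷ y ∷ π) (h , a) zero    (suc zero) _  y<x = h y<x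
  Avoids⇒≤ p (x ∷ y ∷ π) (h , a) (suc j) (suc j⁺)       eq lt  =
    ≤-trans (m≤m⊔n p (toℕ x)) (Avoids⇒≤ (p ⊔ toℕ x) (y ∷ π) a j j⁺ (suc-injective eq) lt)

  Avoids⇒321-free : ∀ {n m} p (π : Vec (Fin n) m) → Avoids p (letters π) → 321-free π
  Avoids⇒321-free p (x ∷ y ∷ π) (h , a) zero    (suc j) (suc j⁺) i<j       eq lt =
    ≤-trans (m≤n⊔m p (toℕ x)) (Avoids⇒≤ (p ⊔ toℕ x) (y ∷ π) a j j⁺ (suc-injective eq) lt)
  Avoids⇒321-free p (x ∷ y ∷ π) (h , a) (suc i) (suc j) (suc j⁺) (s≤s i<j) eq lt =
    Avoids⇒321-free (p ⊔ toℕ x) (y ∷ π) a i j j⁺ i<j (suc-injective eq) lt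

  -- The hypothesis on `p` carries the demands of the letters already read. Passing over `x` adds
  -- the instances of `321-free` in which `x` is the 3.
  321-free⇒Avoids : ∀ {n m} p (π : Vec (Fin n) m) →
    (∀ j j⁺ → toℕ j⁺ ≡ suc (toℕ j) → lookup π j⁺ Fin.< lookup π j → p ≤ toℕ (lookup π j)) →
    321-free π → Avoids p (letters π)
  321-free⇒Avoids p []          _ _    = tt
  321-free⇒Avoids p (x ∷ [])    _ _    = tt
  321-free⇒Avoids p (x ∷ y ∷ π) h free =
    h zero (suc zero) refl ,
    321-free⇒Avoids (p ⊔ toℕ x) (y ∷ π)
      (λ j j⁺ eq lt → ⊔-lub (h (suc j) (suc j⁺) (cong suc eq) lt)
        (free zero (suc j) (suc j⁺) (s≤s z≤n) (cong suc eq) lt))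
      (λ i j j⁺ i<j eq lt → free (suc i) (suc j) (suc j⁺) (s≤s i<j) (cong suc eq) lt)

  SameOrder : ℕ → ℕ → ℕ → ℕ → Set
  SameOrder x y z w = (x < y → z < w) × (z < w → x < y)

  tie : ∀ x z → SameOrder x x z z
  tie x z = (λ lt → contradiction lt (<-irrefl refl)) , (λ lt → contradiction lt (<-irrefl refl))

  ascent : ∀ {x y z w} → x < y → z < w → SameOrder x y z w
  ascent x<y z<w = (λ _ → z<w) , (λ _ → x<y)

  descent : ∀ {x y z w} → x < y → z < w → SameOrder y x w z
  descent x<y z<w = (λ y<x → contradiction x<y (<-asym y<x)) , (λ w<z → contradiction z<w (<-asym w<z))

  321-isomorphic : ∀ {a b c} → b < a → c < b → OrderIsomorphic (a ∷ b ∷ c ∷ []) (3 ∷ 2 ∷ 1 ∷ [])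
  321-isomorphic {a} {b} {c} b<a c<b = λ where
    zero             zero             → tie a 3
    zero             (suc zero)       → descent b<a (n<1+n 2)
    zero             (suc (suc zero)) → descent (<-trans c<b b<a) (s≤s (s≤s z≤n))
    (suc zero)       zero             → ascent b<a (n<1+n 2)
    (suc zero)       (suc zero)       → tie b 2
    (suc zero)       (suc (suc zero)) → descent c<b (n<1+n 1)
    (suc (suc zero)) zero             → ascent (<-trans c<b b<a) (s≤s (s≤s z≤n))
    (suc (suc zero)) (suc zero)       → ascent c<b (n<1+n 1)
    (suc (suc zero)) (suc (suc zero)) → tie c 1

  Avoids⇔ : ∀ {n} (π : Word n) → (¬ Contains3-21 π) ⇔ Avoids 0 (letters π)
  Avoids⇔ π = mk⇔
    (λ ¬c → 321-free⇒Avoids 0 π (λ _ _ _ _ → z≤n) λ i j j⁺ i<j eq lt →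
      ≮⇒≥ λ gt → ¬c (i , j , j⁺ , i<j , eq , 321-isomorphic gt lt))
    (λ a (i , j , j⁺ , i<j , eq , iso) → ≤⇒≯
      (Avoids⇒321-free 0 π a i j j⁺ i<j eq (proj₂ (iso (suc (suc zero)) (suc zero)) (n<1+n 1)))
      (proj₂ (iso (suc zero) zero) (n<1+n 2)))

  -- The filtered list and the generated list have the same members and no repetitions, so they are
  -- permutations of each other and have equal length.
  N≡count : ∀ {k} (p : Vec ℕ k) j n → (∀ (π : Word n) → BeginsWith p π ⇔ Begins j (letters π)) →
    N p n ≡ count j n n
  N≡count p j n begins = begin
    length counted                  ≡⟨ List.length-map letters counted ⟨
    length (map letters counted)    ≡⟨ ↭.↭-length (∼bag⇒↭ (unique∧set⇒bag
      (Unique.map⁺ letters-injective (Unique.filter⁺ (counted? p) (words-unique n n)))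
      (gen-unique j n S↓) (mk⇔ to from))) ⟩
    length (gen j n (downFrom n))   ≡⟨ length-gen j n (downFrom n) ⟩
    count j n (length (downFrom n)) ≡⟨ cong (count j n) (List.length-downFrom n) ⟩
    count j n n                     ∎
    where
    open ≡-Reasoning
    open Equivalence using () renaming (to to to′; from to from′)
    counted = filter (counted? p) (words n n)
    S↓ = downFrom-decreasing n

    to : ∀ {w} → w ∈ map letters counted → w ∈ gen j n (downFrom n)
    to w∈ with π , π∈ , refl ← ∈-map⁻ letters w∈
      with _ , π! , ¬c , b ← ∈-filter⁻ (counted? p) {xs = words n n} π∈ =
      gen-complete j n (≤-reflexive (List.length-downFrom n)) S↓
        (to′ (Avoids⇔ π) ¬c , to′ (begins π) b , letters-↭ π π!)

    from : ∀ {w} → w ∈ gen j n (downFrom n) → w ∈ map letters counted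
    from {w} w∈ with a , b , w↭ ← gen-sound j n S↓ w∈
      with π , refl ← letters-surjective {n} w
        (↭.All-resp-↭ (↭-sym w↭) (All.tabulate ∈-downFrom⁻))
        (trans (↭.↭-length w↭) (List.length-downFrom n)) =
      ∈-map⁺ letters (∈-filter⁺ (counted? p) (words-complete π)
        ( letters-unique⁻ (Unique-resp-↭ (↭-sym w↭) (Decreasing⇒Unique S↓))
        , from′ (Avoids⇔ π) a
        , from′ (begins π) b))

  Prefix : ∀ {n m k} → Vec ℕ k → Vec (Fin n) m → Set
  Prefix {m = m} {k} p π = Σ (k ≤ m) λ k≤m → OrderIsomorphic (Vec.map toℕ (truncate k≤m π)) p

  -- Restricted to nonempty words: on the empty one `BeginsWith` holds by convention while `Begins`
  -- fails. `N-1` adds that word back.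
  begins-1 : ∀ {n} (π : Word (suc n)) → BeginsWith (pattern-k 1) π ⇔ Begins 0 (letters π)
  begins-1 (x ∷ π) = mk⇔ (λ _ → tt) (λ _ → inj₁ (s≤s z≤n , λ where
    zero zero → tie (toℕ x) 1))

  begins-2 : ∀ {n} (π : Word n) → BeginsWith (pattern-k 2) π ⇔ Begins 1 (letters π)
  begins-2 π = mk⇔ (λ { (inj₁ b) → to π b ; (inj₂ (() , _)) }) (inj₁ ∘ from π)
    where
    to : ∀ {n m} (π : Vec (Fin n) m) → Prefix (pattern-k 2) π → Begins 1 (letters π)
    to (x ∷ y ∷ π) (s≤s (s≤s z≤n) , iso) = proj₂ (iso zero (suc zero)) (n<1+n 1)
    from : ∀ {n m} (π : Vec (Fin n) m) → Begins 1 (letters π) → Prefix (pattern-k 2) π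
    from (x ∷ y ∷ π) x<y = s≤s (s≤s z≤n) , λ where
      zero       zero       → tie (toℕ x) 1
      zero       (suc zero) → ascent x<y (n<1+n 1)
      (suc zero) zero       → descent x<y (n<1+n 1)
      (suc zero) (suc zero) → tie (toℕ y) 2

  begins-3 : ∀ {n} (π : Word n) → BeginsWith (pattern-k 3) π ⇔ Begins 2 (letters π)
  begins-3 π = mk⇔ (λ { (inj₁ b) → to π b ; (inj₂ (() , _)) }) (inj₁ ∘ from π)
    where
    to : ∀ {n m} (π : Vec (Fin n) m) → Prefix (pattern-k 3) π → Begins 2 (letters π)
    to (x ∷ y ∷ z ∷ π) (s≤s (s≤s (s≤s z≤n)) , iso) =
      proj₂ (iso (suc zero) zero) (n<1+n 1) , proj₂ (iso zero (suc (suc zero))) (n<1+n 2)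
    from : ∀ {n m} (π : Vec (Fin n) m) → Begins 2 (letters π) → Prefix (pattern-k 3) π
    from (x ∷ y ∷ z ∷ π) (y<x , x<z) = s≤s (s≤s (s≤s z≤n)) , λ where
      zero             zero             → tie (toℕ x) 2
      zero             (suc zero)       → descent y<x (n<1+n 1)
      zero             (suc (suc zero)) → ascent x<z (n<1+n 2)
      (suc zero)       zero             → ascent y<x (n<1+n 1)
      (suc zero)       (suc zero)       → tie (toℕ y) 1
      (suc zero)       (suc (suc zero)) → ascent (<-trans y<x x<z) (s≤s (s≤s z≤n))
      (suc (suc zero)) zero             → descent x<z (n<1+n 2)
      (suc (suc zero)) (suc zero)       → descent (<-trans y<x x<z) (s≤s (s≤s z≤n))
      (suc (suc zero)) (suc (suc zero)) → tie (toℕ z) 3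

  -- For k ≥ 4 the pattern starts with the three decreasing letters k-1, k-2, k-3, which already
  -- form an occurrence of 3-21.
  begins-4⇒¬Avoids : ∀ i {n m} (π : Vec (Fin n) m) → Prefix (pattern-k (4 + i)) π → ¬ Avoids 0 (letters π)
  begins-4⇒¬Avoids i (x ∷ y ∷ z ∷ u ∷ π) (s≤s (s≤s (s≤s (s≤s _))) , iso) (_ , h , _) =
    <⇒≱ (proj₂ (iso (suc zero) zero) (n<1+n _)) (h (proj₂ (iso (suc (suc zero)) (suc zero)) (n<1+n _)))

  N-pattern-4 : ∀ i n → N (pattern-k (4 + i)) n ≡ 0
  N-pattern-4 i n = cong length (List.filter-none (counted? (pattern-k (4 + i))) {words n n}
    (All.tabulate λ { {π} _ (_ , _ , inj₂ (() , _)) ; {π} _ (_ , ¬c , inj₁ b) →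
      begins-4⇒¬Avoids i π b (Equivalence.to (Avoids⇔ π) ¬c) }))

open import Algebra.Bundles using (RawSemiring; CommutativeRing)
import Algebra.Definitions.RawSemiring as RawSemiringDefinitions
import Algebra.Properties.Semiring.Sum as SemiringSum
open import Data.Integer.Base as ℤ using (+_)
import Data.Integer.Properties as ℤ
open import Data.Rational.Base as ℚ using (ℚ; 0ℚ; 1ℚ; ½; _+_; _*_; -_; _-_; ∣_∣; _/_)
import Data.Rational.Properties as ℚ
open import Data.Rational.Solver using (module +-*-Solver)
import Data.Rational.Unnormalised.Base as ℚᵘ
import Data.Rational.Unnormalised.Properties as ℚᵘ

open Counting using (binom; binom-cong; count; count-stable; δ; N≡count; N-pattern-4;
  begins-1; begins-2; begins-3)
open +-*-Solver
open ExpEstimates using (#; #-suc; 1/!-suc; sum-suc)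
open SemiringSum (CommutativeRing.semiring ℚ.+-*-commutativeRing)
  using (sum; sum-cong-≗; *-distribˡ-sum)
open RawSemiring ℚ⟦x⟧ using () renaming (_*_ to infixl 7 _⊗_)
open RawSemiringDefinitions ℝ-rawSemiring using () renaming (sum to sumʳ)
open RawSemiringDefinitions ℚ.+-*-rawSemiring using (_^_)

-- Formal power series over ℚ

module _ where

  open ≡-Reasoning

  Seq : Set
  Seq = ℕ → ℚ

  tail : Seq → Seq
  tail f n = f (suc n)

  infixr 8 _·_
  _·_ : ℚ → Seq → Seq
  (c · f) n = c * f n

  -- Agreement up to `n` is all that is at hand where the rest is not yet known, as in `D-unique`,
  -- or can fail, as for the truncated exponentials in `D-Exp₀`.
  ⊗-cong-≤ : ∀ f {g g′} n → (∀ m → m ℕ.≤ n → g m ≡ g′ m) → (f ⊗ g) n ≡ (f ⊗ g′) n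
  ⊗-cong-≤ f zero    g≡ = cong (λ y → f 0 * y + 0ℚ) (g≡ 0 z≤n)
  ⊗-cong-≤ f (suc n) g≡ = cong₂ _+_ (cong (f 0 *_) (g≡ (suc n) ℕ.≤-refl))
    (⊗-cong-≤ (tail f) n λ m m≤n → g≡ m (ℕ.m≤n⇒m≤1+n m≤n))

  ⊗-congˡ : ∀ f {g g′} → g ≗ g′ → f ⊗ g ≗ f ⊗ g′
  ⊗-congˡ f g≗ n = ⊗-cong-≤ f n λ m _ → g≗ m

  ⊗-congʳ : ∀ {f f′} g → f ≗ f′ → f ⊗ g ≗ f′ ⊗ g
  ⊗-congʳ g f≗ zero    = cong (λ x → x * g 0 + 0ℚ) (f≗ 0)
  ⊗-congʳ g f≗ (suc n) = cong₂ _+_ (cong (_* g (suc n)) (f≗ 0))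
    (⊗-congʳ g (f≗ ∘ suc) n)

  ⊗-distribʳ : ∀ h f g → (f ⊕ g) ⊗ h ≗ (f ⊗ h) ⊕ (g ⊗ h)
  ⊗-distribʳ h f g zero    = solve 3 (λ f g h →
    (f :+ g) :* h :+ con 0ℚ := (f :* h :+ con 0ℚ) :+ (g :* h :+ con 0ℚ))
    refl (f 0) (g 0) (h 0)
  ⊗-distribʳ h f g (suc n) = trans
    (cong (λ z → (f 0 + g 0) * h (suc n) + z) (⊗-distribʳ h (tail f) (tail g) n))
    (solve 5 (λ f g h x y → (f :+ g) :* h :+ (x :+ y) := (f :* h :+ x) :+ (g :* h :+ y))
      refl (f 0) (g 0) (h (suc n)) ((tail f ⊗ h) n) ((tail g ⊗ h) n))

  ⊗-·ˡ : ∀ c f g → (c · f) ⊗ g ≗ c · (f ⊗ g)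
  ⊗-·ˡ c f g zero    = solve 3 (λ c f g →
    (c :* f) :* g :+ con 0ℚ := c :* (f :* g :+ con 0ℚ)) refl c (f 0) (g 0)
  ⊗-·ˡ c f g (suc n) = trans (cong (λ z → c * f 0 * g (suc n) + z) (⊗-·ˡ c (tail f) g n))
    (solve 4 (λ c f g x → c :* f :* g :+ c :* x := c :* (f :* g :+ x))
      refl c (f 0) (g (suc n)) ((tail f ⊗ g) n))

  ⊗-zeroˡ : ∀ g n → ((λ _ → 0ℚ) ⊗ g) n ≡ 0ℚ
  ⊗-zeroˡ g zero    = trans (cong (_+ 0ℚ) (ℚ.*-zeroˡ (g 0))) (ℚ.+-identityʳ 0ℚ)
  ⊗-zeroˡ g (suc n) = trans (cong₂ _+_ (ℚ.*-zeroˡ (g (suc n))) (⊗-zeroˡ g n))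
    (ℚ.+-identityʳ 0ℚ)

  ⊗-identityˡ : ∀ g → 1ˢ ⊗ g ≗ g
  ⊗-identityˡ g zero    = trans (ℚ.+-identityʳ _) (ℚ.*-identityˡ (g 0))
  ⊗-identityˡ g (suc n) = trans (cong₂ _+_ (ℚ.*-identityˡ (g (suc n))) (⊗-zeroˡ g n))
    (ℚ.+-identityʳ (g (suc n)))

  -- The definition of the product peels off the first term of the convolution. Peeling off the last
  -- one instead gives the mirror image that commutativity needs.
  ⊗-sucʳ : ∀ f g n → (f ⊗ g) (suc n) ≡ (f ⊗ tail g) n + f (suc n) * g 0
  ⊗-sucʳ f g zero    = solve 4 (λ f₀ g₀ f₁ g₁ →
    f₀ :* g₁ :+ (f₁ :* g₀ :+ con 0ℚ) := (f₀ :* g₁ :+ con 0ℚ) :+ f₁ :* g₀)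
    refl (f 0) (g 0) (f 1) (g 1)
  ⊗-sucʳ f g (suc n) = trans
    (cong (λ z → f 0 * g (suc (suc n)) + z) (⊗-sucʳ (tail f) g n))
    (sym (ℚ.+-assoc (f 0 * g (suc (suc n))) ((tail f ⊗ tail g) n) (f (suc (suc n)) * g 0)))

  ⊗-comm : ∀ f g → f ⊗ g ≗ g ⊗ f
  ⊗-comm f g zero    = cong (_+ 0ℚ) (ℚ.*-comm (f 0) (g 0))
  ⊗-comm f g (suc n) = begin
    f 0 * g (suc n) + (tail f ⊗ g) n
      ≡⟨ cong₂ _+_ (ℚ.*-comm (f 0) (g (suc n))) (⊗-comm (tail f) g n) ⟩
    g (suc n) * f 0 + (g ⊗ tail f) n
      ≡⟨ ℚ.+-comm (g (suc n) * f 0) ((g ⊗ tail f) n) ⟩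
    (g ⊗ tail f) n + g (suc n) * f 0
      ≡⟨ ⊗-sucʳ g f n ⟨
    (g ⊗ f) (suc n) ∎

  ⊗-assoc : ∀ f g h → (f ⊗ g) ⊗ h ≗ f ⊗ (g ⊗ h)
  ⊗-assoc f g h zero    = solve 3 (λ f g h →
    (f :* g :+ con 0ℚ) :* h :+ con 0ℚ := f :* (g :* h :+ con 0ℚ) :+ con 0ℚ)
    refl (f 0) (g 0) (h 0)
  ⊗-assoc f g h (suc n) = begin
    -- The tail of `f ⊗ g` is `(f 0 · tail g) ⊕ (tail f ⊗ g)` by definition.
    (f 0 * g 0 + 0ℚ) * h (suc n) + (((f 0 · tail g) ⊕ (tail f ⊗ g)) ⊗ h) n
      ≡⟨ cong (λ z → (f 0 * g 0 + 0ℚ) * h (suc n) + z) (⊗-distribʳ h (f 0 · tail g) (tail f ⊗ g) n) ⟩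
    (f 0 * g 0 + 0ℚ) * h (suc n) + (((f 0 · tail g) ⊗ h) n + ((tail f ⊗ g) ⊗ h) n)
      ≡⟨ cong₂ (λ y z → (f 0 * g 0 + 0ℚ) * h (suc n) + (y + z))
           (⊗-·ˡ (f 0) (tail g) h n) (⊗-assoc (tail f) g h n) ⟩
    (f 0 * g 0 + 0ℚ) * h (suc n) + (f 0 * (tail g ⊗ h) n + (tail f ⊗ (g ⊗ h)) n)
      ≡⟨ solve 5 (λ f g h x y →
           (f :* g :+ con 0ℚ) :* h :+ (f :* x :+ y) := f :* (g :* h :+ x) :+ y)
           refl (f 0) (g 0) (h (suc n)) ((tail g ⊗ h) n) ((tail f ⊗ (g ⊗ h)) n) ⟩
    f 0 * (g 0 * h (suc n) + (tail g ⊗ h) n) + (tail f ⊗ (g ⊗ h)) n ∎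

  ⊗-distribˡ : ∀ f g h → f ⊗ (g ⊕ h) ≗ (f ⊗ g) ⊕ (f ⊗ h)
  ⊗-distribˡ f g h n = trans (⊗-comm f (g ⊕ h) n) (trans (⊗-distribʳ f g h n)
    (cong₂ _+_ (⊗-comm g f n) (⊗-comm h f n)))

  ⊗-·ʳ : ∀ c f g → f ⊗ (c · g) ≗ c · (f ⊗ g)
  ⊗-·ʳ c f g n = trans (⊗-comm f (c · g) n) (trans (⊗-·ˡ c g f n)
    (cong (c *_) (⊗-comm g f n)))

  ⊗-zeroʳ : ∀ f n → (f ⊗ (λ _ → 0ℚ)) n ≡ 0ℚ
  ⊗-zeroʳ f n = trans (⊗-comm f (λ _ → 0ℚ) n) (⊗-zeroˡ f n)

  ⊗-identityʳ : ∀ f → f ⊗ 1ˢ ≗ f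
  ⊗-identityʳ f n = trans (⊗-comm f 1ˢ n) (⊗-identityˡ f n)

  ⊗-sum : ∀ f {k} (g : Fin k → Seq) n →
    (f ⊗ λ m → sum λ i → g i m) n ≡ sum λ i → (f ⊗ g i) n
  ⊗-sum f {zero}  g n = ⊗-zeroʳ f n
  ⊗-sum f {suc k} g n = trans
    (⊗-distribˡ f (g zero) (λ m → sum λ i → g (suc i) m) n)
    (cong (λ z → (f ⊗ g zero) n + z) (⊗-sum f (g ∘ suc) n))

  D : Seq → Seq
  D f n = # (suc n) * f (suc n)

  D-cong : ∀ {f g} → f ≗ g → D f ≗ D g
  D-cong f≗g n = cong (# (suc n) *_) (f≗g (suc n))

  D-⊕ : ∀ f g → D (f ⊕ g) ≗ D f ⊕ D g
  D-⊕ f g n = ℚ.*-distribˡ-+ (# (suc n)) (f (suc n)) (g (suc n))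

  D-· : ∀ c f → D (c · f) ≗ c · D f
  D-· c f n = solve 3 (λ k c x → k :* (c :* x) := c :* (k :* x)) refl
    (# (suc n)) c (f (suc n))

  D-⊖ : ∀ f → D (⊖ f) ≗ ⊖ D f
  D-⊖ f n = solve 2 (λ k x → k :* (:- x) := :- (k :* x)) refl (# (suc n)) (f (suc n))

  tail-D : ∀ f → tail (D f) ≗ tail (tail f) ⊕ D (tail f)
  tail-D f n = trans (cong (_* f (suc (suc n))) (#-suc (suc n)))
    (solve 2 (λ k x → (k :+ con 1ℚ) :* x := x :+ k :* x) refl
      (# (suc n)) (f (suc (suc n))))

  leibniz : ∀ f g → D (f ⊗ g) ≗ (D f ⊗ g) ⊕ (f ⊗ D g)
  leibniz f g zero    = solve 4 (λ f₀ f₁ g₀ g₁ →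
    con 1ℚ :* (f₀ :* g₁ :+ (f₁ :* g₀ :+ con 0ℚ)) :=
    (con 1ℚ :* f₁ :* g₀ :+ con 0ℚ) :+ (f₀ :* (con 1ℚ :* g₁) :+ con 0ℚ))
    refl (f 0) (f 1) (g 0) (g 1)
  leibniz f g (suc n) = begin
    # (suc (suc n)) * (f 0 * G + T)
      ≡⟨ ℚ.*-distribˡ-+ (# (suc (suc n))) (f 0 * G) T ⟩
    # (suc (suc n)) * (f 0 * G) + # (suc (suc n)) * T
      ≡⟨ cong₂ _+_
           (solve 3 (λ k x y → k :* (x :* y) := x :* (k :* y)) refl (# (suc (suc n))) (f 0) G)
           -- `ℕ.pred` provides a series with tail `f′ ⊗ g`; `tail-D` then splits the factor n + 2
           -- as 1 + (n + 1), and the induction hypothesis applies to the second part.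
           (trans (tail-D (λ m → (f′ ⊗ g) (ℕ.pred m)) n)
             (cong (λ z → T + z) (leibniz f′ g n))) ⟩
    f 0 * D g (suc n) + (f 1 * g (suc n) + T″ + (P + Q))
      ≡⟨ solve 5 (λ a b t p q → a :+ (b :+ t :+ (p :+ q)) := b :+ (t :+ p) :+ (a :+ q)) refl
           (f 0 * D g (suc n)) (f 1 * g (suc n)) T″ P Q ⟩
    (f 1 * g (suc n) + (T″ + P)) + (f 0 * D g (suc n) + Q)
      ≡⟨ cong (_+ (f 0 * D g (suc n) + Q)) (cong₂ _+_
           (cong (_* g (suc n)) (sym (ℚ.*-identityˡ (f 1))))
           (sym (trans (⊗-congʳ g (tail-D f) n) (⊗-distribʳ g (tail f′) (D f′) n)))) ⟩
    (D f ⊗ g) (suc n) + (f ⊗ D g) (suc n) ∎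
    where
    f′ = tail f
    G  = g (suc (suc n))
    T  = (f′ ⊗ g) (suc n)
    T″ = (tail f′ ⊗ g) n
    P  = (D f′ ⊗ g) n
    Q  = (f′ ⊗ D g) n

  #-cancel : ∀ n {p q} → # (suc n) * p ≡ # (suc n) * q → p ≡ q
  #-cancel n {p} {q} eq = begin
    p                               ≡⟨ unit p ⟩
    ℚ.1/ k * (k * p)                ≡⟨ cong (ℚ.1/ k *_) eq ⟩
    ℚ.1/ k * (k * q)                ≡⟨ unit q ⟨
    q                               ∎
    where
    k = # (suc n)
    unit : ∀ r → r ≡ ℚ.1/ k * (k * r)
    unit r = sym (trans (sym (ℚ.*-assoc (ℚ.1/ k) k r))
      (trans (cong (_* r) (ℚ.*-inverseˡ k)) (ℚ.*-identityˡ r)))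

  -- A linear differential equation y′ = g y + c determines y from y(0).
  D-unique : ∀ g c {f f′} → f 0 ≡ f′ 0 →
    D f ≗ (g ⊗ f) ⊕ c → D f′ ≗ (g ⊗ f′) ⊕ c → f ≗ f′
  D-unique g c {f} {f′} f₀ Df Df′ n = upTo n n ℕ.≤-refl
    where
    upTo : ∀ n m → m ℕ.≤ n → f m ≡ f′ m
    upTo n       zero    _         = f₀
    upTo (suc n) (suc m) (s≤s m≤n) = #-cancel m (begin
      D f m               ≡⟨ Df m ⟩
      (g ⊗ f) m + c m
        ≡⟨ cong (_+ c m) (⊗-cong-≤ g m λ i i≤m → upTo n i (ℕ.≤-trans i≤m m≤n)) ⟩
      (g ⊗ f′) m + c m    ≡⟨ Df′ m ⟨
      D f′ m              ∎)

  D-eˣ : D eˣ ≗ eˣ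
  D-eˣ n = trans (ℚ.*-comm (# (suc n)) (eˣ (suc n))) (1/!-suc n)

  pow : Seq → ℕ → Seq
  pow = _^ˢ_

  D-pow : ∀ h i → D (pow h (suc i)) ≗ # (suc i) · (D h ⊗ pow h i)
  D-pow h zero    n = trans (D-cong (⊗-identityʳ h) n)
    (sym (trans (ℚ.*-identityˡ _) (⊗-identityʳ (D h) n)))
  D-pow h (suc i) n = begin
    D (h ⊗ pow h (suc i)) n
      ≡⟨ leibniz h (pow h (suc i)) n ⟩
    A + (h ⊗ D (pow h (suc i))) n
      ≡⟨ cong (λ z → A + z) (⊗-congˡ h (D-pow h i) n) ⟩
    A + (h ⊗ (# (suc i) · (D h ⊗ pow h i))) n
      ≡⟨ cong (λ z → A + z) (⊗-·ʳ (# (suc i)) h (D h ⊗ pow h i) n) ⟩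
    A + # (suc i) * (h ⊗ (D h ⊗ pow h i)) n
      ≡⟨ cong (λ z → A + # (suc i) * z) (begin
           (h ⊗ (D h ⊗ pow h i)) n   ≡⟨ ⊗-assoc h (D h) (pow h i) n ⟨
           ((h ⊗ D h) ⊗ pow h i) n   ≡⟨ ⊗-congʳ (pow h i) (⊗-comm h (D h)) n ⟩
           ((D h ⊗ h) ⊗ pow h i) n   ≡⟨ ⊗-assoc (D h) h (pow h i) n ⟩
           A                         ∎) ⟩
    A + # (suc i) * A
      ≡⟨ solve 2 (λ k a → a :+ k :* a := (k :+ con 1ℚ) :* a) refl (# (suc i)) A ⟩
    (# (suc i) + 1ℚ) * A
      ≡⟨ cong (_* A) (#-suc (suc i)) ⟨
    # (suc (suc i)) * A ∎
    where A = (D h ⊗ pow h (suc i)) n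

  pow-vanish : ∀ h → h 0 ≡ 0ℚ → ∀ i n → n ℕ.< i → pow h i n ≡ 0ℚ
  pow-vanish h h₀ (suc i) zero    _         = trans (ℚ.+-identityʳ _)
    (trans (cong (_* pow h i 0) h₀) (ℚ.*-zeroˡ (pow h i 0)))
  pow-vanish h h₀ (suc i) (suc n) (s≤s n<i) = begin
    h 0 * pow h i (suc n) + (tail h ⊗ pow h i) n
      ≡⟨ cong₂ _+_ (trans (cong (_* pow h i (suc n)) h₀) (ℚ.*-zeroˡ (pow h i (suc n))))
           (⊗-cong-≤ (tail h) n λ m m≤n → pow-vanish h h₀ i m (ℕ.≤-<-trans m≤n n<i)) ⟩
    0ℚ + (tail h ⊗ (λ _ → 0ℚ)) n
      ≡⟨ trans (ℚ.+-identityˡ _) (⊗-zeroʳ (tail h) n) ⟩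
    0ℚ ∎

  -- The number `k` of terms is kept apart from the index `n`: `Exp₀` cuts the sum at a length
  -- varying with the coefficient, whereas a product needs one length for all coefficients of its
  -- factor.
  expPartial : Seq → ℕ → Seq
  expPartial f k n = sum {k} λ i → 1/ toℕ i ! * pow (dropConstant f) (toℕ i) n

  -- e^{f - f(0)}
  Exp₀ : Seq → Seq
  Exp₀ f n = expPartial f (suc n) n

  -- By `pow-vanish`, every term added beyond exponent `n` has coefficient 0 at `n`.
  expPartial-stable : ∀ f n k → n ℕ.≤′ k → expPartial f (suc k) n ≡ Exp₀ f n
  expPartial-stable f n .n        ℕ.≤′-refl        = refl
  expPartial-stable f n .(suc k) (ℕ.≤′-step {k} p) = begin
    expPartial f (suc (suc k)) n
      ≡⟨ sum-suc (λ i → 1/ i ! * pow h i n) (suc k) ⟩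
    expPartial f (suc k) n + 1/ suc k ! * pow h (suc k) n
      ≡⟨ cong₂ _+_ (expPartial-stable f n k p)
           (trans (cong (1/ suc k ! *_) (pow-vanish h refl (suc k) n (s≤s (ℕ.≤′⇒≤ p))))
             (ℚ.*-zeroʳ (1/ suc k !))) ⟩
    Exp₀ f n + 0ℚ
      ≡⟨ ℚ.+-identityʳ _ ⟩
    Exp₀ f n ∎
    where h = dropConstant f

  D-Exp₀ : ∀ f → D (Exp₀ f) ≗ D f ⊗ Exp₀ f
  D-Exp₀ f n = begin
    -- The summand `1ℚ * 0ℚ` comes from exponent 0, whose power `1ˢ` has coefficient 0 at `suc n`.
    -- The remaining exponents shift down by one.
    # (suc n) * (1ℚ * 0ℚ + sum {suc n} (λ i → c (suc (toℕ i)) * pow h (suc (toℕ i)) (suc n)))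
      ≡⟨ cong (# (suc n) *_) (ℚ.+-identityˡ (sum {suc n} λ i → c (suc (toℕ i)) * pow h (suc (toℕ i)) (suc n))) ⟩
    # (suc n) * sum {suc n} (λ i → c (suc (toℕ i)) * pow h (suc (toℕ i)) (suc n))
      ≡⟨ *-distribˡ-sum {suc n} (# (suc n)) (λ i → c (suc (toℕ i)) * pow h (suc (toℕ i)) (suc n)) ⟩
    sum {suc n} (λ i → # (suc n) * (c (suc (toℕ i)) * pow h (suc (toℕ i)) (suc n)))
      ≡⟨ sum-cong-≗ {suc n} (λ i → term (toℕ i)) ⟩
    sum {suc n} (λ i → (D f ⊗ (c (toℕ i) · pow h (toℕ i))) n)
      ≡⟨ ⊗-sum (D f) {suc n} (λ i → c (toℕ i) · pow h (toℕ i)) n ⟨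
    (D f ⊗ expPartial f (suc n)) n
      ≡⟨ ⊗-cong-≤ (D f) n (λ m m≤n → expPartial-stable f m n (ℕ.≤⇒≤′ m≤n)) ⟩
    (D f ⊗ Exp₀ f) n ∎
    where
    h = dropConstant f
    c = 1/_!
    -- `D` never reads the constant coefficient, so `D h` and `D f` agree by definition.
    term : ∀ i → # (suc n) * (c (suc i) * pow h (suc i) (suc n)) ≡ (D f ⊗ (c i · pow h i)) n
    term i = begin
      # (suc n) * (c (suc i) * pow h (suc i) (suc n))
        ≡⟨ D-· (c (suc i)) (pow h (suc i)) n ⟩
      c (suc i) * D (pow h (suc i)) n
        ≡⟨ cong (c (suc i) *_) (D-pow h i n) ⟩
      c (suc i) * (# (suc i) * (D h ⊗ pow h i) n)
        ≡⟨ ℚ.*-assoc (c (suc i)) (# (suc i)) _ ⟨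
      c (suc i) * # (suc i) * (D h ⊗ pow h i) n
        ≡⟨ cong (_* (D h ⊗ pow h i) n) (1/!-suc i) ⟩
      c i * (D h ⊗ pow h i) n
        ≡⟨ ⊗-·ʳ (c i) (D f) (pow h i) n ⟨
      (D f ⊗ (c i · pow h i)) n ∎

-- The product of e and 1/e

-1ℚ 2ℚ : ℚ
-1ℚ = - 1ℚ
2ℚ  = 1ℚ + 1ℚ

ones : Seq
ones _ = 1ℚ

module _ where
  open ≡-Reasoning

  D-expTerm : ∀ q → D (expTerm q) ≗ q · expTerm q
  D-expTerm q n = trans (ℚ.*-comm (# (suc n)) (expTerm q (suc n)))
    (ExpEstimates.term-suc q n)

  -- `expTerm q` is the coefficient sequence of e^(qx). Both sides solve y′ = (p + q) y with y(0) =
  -- 1.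
  expTerm-+ : ∀ p q → expTerm p ⊗ expTerm q ≗ expTerm (p + q)
  expTerm-+ p q = D-unique ((p + q) · 1ˢ) (λ _ → 0ℚ) refl
    (λ n → trans (D-product n) (sym (linear (expTerm p ⊗ expTerm q) n)))
    (λ n → trans (D-expTerm (p + q) n) (sym (linear (expTerm (p + q)) n)))
    where
    linear : ∀ f n → (((p + q) · 1ˢ) ⊗ f) n + 0ℚ ≡ (p + q) * f n
    linear f n = trans (ℚ.+-identityʳ _) (trans (⊗-·ˡ (p + q) 1ˢ f n)
      (cong ((p + q) *_) (⊗-identityˡ f n)))

    D-product : ∀ n → D (expTerm p ⊗ expTerm q) n ≡ (p + q) * (expTerm p ⊗ expTerm q) n
    D-product n = begin
      D (expTerm p ⊗ expTerm q) n
        ≡⟨ leibniz (expTerm p) (expTerm q) n ⟩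
      (D (expTerm p) ⊗ expTerm q) n + (expTerm p ⊗ D (expTerm q)) n
        ≡⟨ cong₂ _+_
             (trans (⊗-congʳ (expTerm q) (D-expTerm p) n) (⊗-·ˡ p (expTerm p) (expTerm q) n))
             (trans (⊗-congˡ (expTerm p) (D-expTerm q) n) (⊗-·ʳ q (expTerm p) (expTerm q) n)) ⟩
      p * (expTerm p ⊗ expTerm q) n + q * (expTerm p ⊗ expTerm q) n
        ≡⟨ ℚ.*-distribʳ-+ ((expTerm p ⊗ expTerm q) n) p q ⟨
      (p + q) * (expTerm p ⊗ expTerm q) n ∎

  expTerm-0 : expTerm 0ℚ ≗ 1ˢ
  expTerm-0 zero    = refl
  expTerm-0 (suc n) = trans (cong (_* 1/ suc n !) (ℚ.*-zeroˡ (0ℚ ^ n)))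
    (ℚ.*-zeroˡ (1/ suc n !))

  -- `ones` is the series 1/(1-x), and multiplying by it forms partial sums.
  expSum-⊗ : ∀ q → expSum q ≗ expTerm q ⊗ ones
  expSum-⊗ q n = sum-cong-≗ {suc n} λ i → sym (ℚ.*-identityʳ (expTerm q (toℕ i)))

  expSum-0 : ∀ n → expSum 0ℚ n ≡ 1ℚ
  expSum-0 n = begin
    expSum 0ℚ n            ≡⟨ expSum-⊗ 0ℚ n ⟩
    (expTerm 0ℚ ⊗ ones) n  ≡⟨ ⊗-congʳ ones expTerm-0 n ⟩
    (1ˢ ⊗ ones) n          ≡⟨ ⊗-identityˡ ones n ⟩
    1ℚ                     ∎

  -- In terms of series this is e^x · (e^(-x)/(1-x)) = 1/(1-x).
  expTerm-⊗-expSum : ∀ n → (expTerm 1ℚ ⊗ expSum -1ℚ) n ≡ 1ℚ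
  expTerm-⊗-expSum n = begin
    (expTerm 1ℚ ⊗ expSum -1ℚ) n               ≡⟨ ⊗-congˡ (expTerm 1ℚ) (expSum-⊗ -1ℚ) n ⟩
    (expTerm 1ℚ ⊗ (expTerm -1ℚ ⊗ ones)) n     ≡⟨ ⊗-assoc (expTerm 1ℚ) (expTerm -1ℚ) ones n ⟨
    ((expTerm 1ℚ ⊗ expTerm -1ℚ) ⊗ ones) n     ≡⟨ ⊗-congʳ ones (expTerm-+ 1ℚ -1ℚ) n ⟩
    (expTerm 0ℚ ⊗ ones) n                     ≡⟨ expSum-⊗ 0ℚ n ⟨
    expSum 0ℚ n                               ≡⟨ expSum-0 n ⟩
    1ℚ                                        ∎

  -- Subtracts Σᵢ 1/i! Q(n-i) = 1 from Σᵢ 1/i! Q(n), where Q is expSum -1ℚ.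
  product-error : ∀ n → expSum 1ℚ n * expSum -1ℚ n - 1ℚ ≡
    (expTerm 1ℚ ⊗ (λ m → expSum -1ℚ n - expSum -1ℚ m)) n
  product-error n = sym (begin
    (e ⊗ (λ m → Q n - Q m)) n
      ≡⟨ ⊗-congˡ e (λ m → solve 2 (λ x y → x :- y := x :* con 1ℚ :+ con -1ℚ :* y) refl (Q n) (Q m)) n ⟩
    (e ⊗ ((Q n · ones) ⊕ (-1ℚ · Q))) n
      ≡⟨ ⊗-distribˡ e (Q n · ones) (-1ℚ · Q) n ⟩
    (e ⊗ (Q n · ones)) n + (e ⊗ (-1ℚ · Q)) n
      ≡⟨ cong₂ _+_ (⊗-·ʳ (Q n) e ones n) (⊗-·ʳ -1ℚ e Q n) ⟩
    Q n * (e ⊗ ones) n + -1ℚ * (e ⊗ Q) n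
      ≡⟨ cong₂ (λ x y → Q n * x + -1ℚ * y) (sym (expSum-⊗ 1ℚ n)) (expTerm-⊗-expSum n) ⟩
    Q n * P n + -1ℚ * 1ℚ
      ≡⟨ cong (_+ (-1ℚ * 1ℚ)) (ℚ.*-comm (Q n) (P n)) ⟩
    P n * Q n - 1ℚ ∎)
    where
    e = expTerm 1ℚ
    P = expSum 1ℚ
    Q = expSum -1ℚ

  ∣q^n∣ : ∀ q n → ∣ q ^ n ∣ ≡ ∣ q ∣ ^ n
  ∣q^n∣ q zero    = refl
  ∣q^n∣ q (suc n) = trans (ℚ.∣p*q∣≡∣p∣*∣q∣ q (q ^ n)) (cong (∣ q ∣ *_) (∣q^n∣ q n))

  0≤1/n! : ∀ n → 0ℚ ℚ.≤ 1/ n !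
  0≤1/n! n = ℚ.nonNegative⁻¹ (1/ n !) {{ℚ.normalize-nonNeg 1 (n !) {{n ℕ.!≢0}}}}

  ∣expTerm∣ : ∀ q n → ∣ expTerm q n ∣ ≡ expTerm ∣ q ∣ n
  ∣expTerm∣ q n = trans (ℚ.∣p*q∣≡∣p∣*∣q∣ (q ^ n) (1/ n !))
    (cong₂ _*_ (∣q^n∣ q n) (ℚ.0≤p⇒∣p∣≡p (0≤1/n! n)))

module _ where
  open ℚ.≤-Reasoning

  *-mono-∣∣ : ∀ p q {p′ q′} → ∣ p ∣ ℚ.≤ p′ → ∣ q ∣ ℚ.≤ q′ → ∣ p * q ∣ ℚ.≤ p′ * q′
  *-mono-∣∣ p q {p′} {q′} p≤ q≤ = begin
    ∣ p * q ∣      ≡⟨ ℚ.∣p*q∣≡∣p∣*∣q∣ p q ⟩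
    ∣ p ∣ * ∣ q ∣  ≤⟨ ℚ.*-monoʳ-≤-nonNeg ∣ q ∣ {{ℚ.∣-∣-nonNeg q}} p≤ ⟩
    p′ * ∣ q ∣     ≤⟨ ℚ.*-monoˡ-≤-nonNeg p′
                       {{ℚ.nonNegative (ℚ.≤-trans (ℚ.0≤∣p∣ p) p≤)}} q≤ ⟩
    p′ * q′        ∎

  ⊗-bound : ∀ f g f′ g′ n → (∀ m → m ℕ.≤ n → ∣ f m ∣ ℚ.≤ f′ m) →
    (∀ m → m ℕ.≤ n → ∣ g m ∣ ℚ.≤ g′ m) → ∣ (f ⊗ g) n ∣ ℚ.≤ (f′ ⊗ g′) n
  ⊗-bound f g f′ g′ zero    f≤ g≤ = begin
    ∣ f 0 * g 0 + 0ℚ ∣  ≡⟨ cong ∣_∣ (ℚ.+-identityʳ (f 0 * g 0)) ⟩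
    ∣ f 0 * g 0 ∣       ≤⟨ *-mono-∣∣ (f 0) (g 0) (f≤ 0 z≤n) (g≤ 0 z≤n) ⟩
    f′ 0 * g′ 0         ≡⟨ ℚ.+-identityʳ (f′ 0 * g′ 0) ⟨
    f′ 0 * g′ 0 + 0ℚ    ∎
  ⊗-bound f g f′ g′ (suc n) f≤ g≤ = begin
    ∣ f 0 * g (suc n) + (tail f ⊗ g) n ∣
      ≤⟨ ℚ.∣p+q∣≤∣p∣+∣q∣ (f 0 * g (suc n)) ((tail f ⊗ g) n) ⟩
    ∣ f 0 * g (suc n) ∣ + ∣ (tail f ⊗ g) n ∣
      ≤⟨ ℚ.+-mono-≤ (*-mono-∣∣ (f 0) (g (suc n)) (f≤ 0 z≤n) (g≤ (suc n) ℕ.≤-refl))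
           (⊗-bound (tail f) g (tail f′) g′ n (λ m m≤n → f≤ (suc m) (s≤s m≤n))
             (λ m m≤n → g≤ m (ℕ.m≤n⇒m≤1+n m≤n))) ⟩
    f′ 0 * g′ (suc n) + (tail f′ ⊗ g′) n ∎

  expSum-tail : ∀ q m n → ExpEstimates.M q ℕ.≤ m → m ℕ.≤ n →
    ∣ expSum q n - expSum q m ∣ + ∣ expTerm q n ∣ ℚ.≤ ∣ expTerm q m ∣
  expSum-tail q m n M≤m m≤n =
    subst (λ z → ∣ expSum q z - expSum q m ∣ + ∣ expTerm q z ∣ ℚ.≤ ∣ expTerm q m ∣)
      (ℕ.m∸n+n≡m m≤n) (ExpEstimates.tail q m M≤m (n ℕ.∸ m))

  remainder-large : ∀ m n → 2 ℕ.≤ m → m ℕ.≤ n →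
    ∣ expSum -1ℚ n - expSum -1ℚ m ∣ ℚ.≤ ∣ expTerm -1ℚ m ∣
  remainder-large m n 2≤m m≤n = ℚ.≤-trans
    (Estimates.p≤p+q ∣ expSum -1ℚ n - expSum -1ℚ m ∣ (ℚ.0≤∣p∣ (expTerm -1ℚ n)))
    -- The threshold `ExpEstimates.M -1ℚ` computes to 2, from ∣-1∣ + ∣-1∣.
    (expSum-tail -1ℚ m n 2≤m m≤n)

  -- The geometric tail estimate starts at 2, so m = 0 and m = 1 go through Q(2).
  remainder-small : ∀ m n → 2 ℕ.≤ n → ∣ expSum -1ℚ 2 - expSum -1ℚ m ∣ ≡ ½ →
    ∣ expSum -1ℚ n - expSum -1ℚ m ∣ ℚ.≤ 1ℚ
  remainder-small m n 2≤n half = begin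
    ∣ Q n - Q m ∣
      ≡⟨ cong ∣_∣ (solve 3 (λ x y z → x :- z := (x :- y) :+ (y :- z)) refl (Q n) (Q 2) (Q m)) ⟩
    ∣ (Q n - Q 2) + (Q 2 - Q m) ∣
      ≤⟨ ℚ.∣p+q∣≤∣p∣+∣q∣ (Q n - Q 2) (Q 2 - Q m) ⟩
    ∣ Q n - Q 2 ∣ + ∣ Q 2 - Q m ∣
      ≡⟨ cong (λ z → ∣ Q n - Q 2 ∣ + z) half ⟩
    ∣ Q n - Q 2 ∣ + ½
      ≤⟨ ℚ.+-monoˡ-≤ ½ (remainder-large 2 n ℕ.≤-refl 2≤n) ⟩
    ½ + ½
      ≡⟨ refl ⟩
    1ℚ ∎
    where Q = expSum -1ℚ

  remainder : ∀ n → 2 ℕ.≤ n → ∀ m → m ℕ.≤ n →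
    ∣ expSum -1ℚ n - expSum -1ℚ m ∣ ℚ.≤ ∣ expTerm -1ℚ m ∣
  -- Here Q(0) = 1, Q(1) = 0 and Q(2) = 1/2, so both distances to Q(2) are ½ by computation, and the
  -- bound 1 is the absolute value of the term at 0 and at 1.
  remainder n 2≤n 0 _               = remainder-small 0 n 2≤n refl
  remainder n 2≤n 1 _               = remainder-small 1 n 2≤n refl
  remainder n 2≤n (suc (suc m)) m≤n = remainder-large (suc (suc m)) n (s≤s (s≤s z≤n)) m≤n

  -- Bounding each remainder by its term turns the error into the convolution of 1/i! with itself,
  -- the coefficient of e^x · e^x = e^(2x).
  product-bound : ∀ n → 2 ℕ.≤ n → ∣ expSum 1ℚ n * expSum -1ℚ n - 1ℚ ∣ ℚ.≤ expTerm 2ℚ n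
  product-bound n 2≤n = begin
    ∣ expSum 1ℚ n * expSum -1ℚ n - 1ℚ ∣
      ≡⟨ cong ∣_∣ (product-error n) ⟩
    ∣ (expTerm 1ℚ ⊗ (λ m → expSum -1ℚ n - expSum -1ℚ m)) n ∣
      ≤⟨ ⊗-bound (expTerm 1ℚ) (λ m → expSum -1ℚ n - expSum -1ℚ m) (expTerm 1ℚ) (expTerm 1ℚ) n
           (λ m _ → ℚ.≤-reflexive (∣expTerm∣ 1ℚ m))
           (λ m m≤n → ℚ.≤-trans (remainder n 2≤n m m≤n) (ℚ.≤-reflexive (∣expTerm∣ -1ℚ m))) ⟩
    (expTerm 1ℚ ⊗ expTerm 1ℚ) n
      ≡⟨ expTerm-+ 1ℚ 1ℚ n ⟩
    expTerm 2ℚ n ∎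

  -- `t-small` gives a single small term beyond the threshold; by the tail estimate all later terms
  -- are no larger.
  expTerm-small : ∀ q ε → 0ℚ ℚ.< ε → ∃ λ M → ∀ n → M ℕ.≤ n → ∣ expTerm q n ∣ ℚ.< ε
  expTerm-small q ε 0<ε = go (ExpEstimates.t-small q ε 0<ε)
    where
    go : (∃ λ j → ∣ expTerm q (j ℕ.+ ExpEstimates.M q) ∣ ℚ.< ε) →
      ∃ λ M → ∀ n → M ℕ.≤ n → ∣ expTerm q n ∣ ℚ.< ε
    go (j , small) = m , λ n m≤n → ℚ.≤-<-trans
      (ℚ.≤-trans (Estimates.p≤q+p ∣ expTerm q n ∣ (ℚ.0≤∣p∣ (expSum q n - expSum q m)))
        (expSum-tail q m n (ℕ.m≤n+m (ExpEstimates.M q) j) m≤n)) small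
      where m = j ℕ.+ ExpEstimates.M q

  product-limit : ∀ q ε → 0ℚ ℚ.< ε →
    ∃ λ M → ∀ n → M ℕ.≤ n → ∣ q - expSum 1ℚ n * expSum -1ℚ n * q ∣ ℚ.< ε
  product-limit q ε 0<ε = go (Estimates.divide B ε 0<B)
    where
    -- The added 1 keeps the divisor positive when `q` is 0.
    B = ∣ q ∣ + 1ℚ
    0<B = ℚ.<-≤-trans Estimates.0<1 (Estimates.p≤q+p 1ℚ (ℚ.0≤∣p∣ q))

    close : ∀ δ → B * δ ≡ ε → ∀ n → 2 ℕ.≤ n → ∣ expTerm 2ℚ n ∣ ℚ.< δ →
      ∣ q - expSum 1ℚ n * expSum -1ℚ n * q ∣ ℚ.< ε
    close δ Bδ n 2≤n small = begin-strict
      ∣ q - x * q ∣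
        ≡⟨ cong ∣_∣ (solve 2 (λ q x → q :- x :* q := :- (q :* (x :- con 1ℚ))) refl q x) ⟩
      ∣ - (q * (x - 1ℚ)) ∣
        ≡⟨ ℚ.∣-p∣≡∣p∣ (q * (x - 1ℚ)) ⟩
      ∣ q * (x - 1ℚ) ∣
        <⟨ Estimates.*-bound q (x - 1ℚ)
             (Estimates.p≤p+q ∣ q ∣ (ℚ.<⇒≤ Estimates.0<1)) 0<B
             (ℚ.≤-<-trans (product-bound n 2≤n)
               (subst (ℚ._< δ) (∣expTerm∣ 2ℚ n) small)) ⟩
      B * δ
        ≡⟨ Bδ ⟩
      ε ∎
      where x = expSum 1ℚ n * expSum -1ℚ n

    go : (∃ λ δ → (0ℚ ℚ.< ε → 0ℚ ℚ.< δ) × B * δ ≡ ε) →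
      ∃ λ M → ∀ n → M ℕ.≤ n → ∣ q - expSum 1ℚ n * expSum -1ℚ n * q ∣ ℚ.< ε
    go (δ , 0<δ , Bδ) = combine (expTerm-small 2ℚ δ (0<δ 0<ε))
      where
      combine : (∃ λ M → ∀ n → M ℕ.≤ n → ∣ expTerm 2ℚ n ∣ ℚ.< δ) →
        ∃ λ M → ∀ n → M ℕ.≤ n → ∣ q - expSum 1ℚ n * expSum -1ℚ n * q ∣ ℚ.< ε
      combine (M , small) = 2 ℕ.⊔ M , λ n M≤n →
        close δ Bδ n (Estimates.⊔-≤ˡ 2 M M≤n) (small n (Estimates.⊔-≤ʳ 2 M M≤n))

-- Reduction of the real series to rational ones, and the solution formula

integral : Seq → Seq
integral f zero    = 0ℚ
integral f (suc n) = (+ 1 / suc n) * f n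

-- Real operations act termwise on Cauchy sequences, so fixing the index `m` gives a rational series
-- to which the identities above apply exactly.
approximant : ℕ → (ℕ → ℝ) → Seq
approximant m F n = seq (F n) m

module _ where
  open ≡-Reasoning

  seq-sum : ∀ {k} (F : Fin k → ℝ) m → seq (sumʳ F) m ≡ sum λ i → seq (F i) m
  seq-sum {zero}  F m = refl
  seq-sum {suc k} F m = cong (λ z → seq (F zero) m + z) (seq-sum (F ∘ suc) m)

  -- Products are named by variables and equations here and below: comparing
  -- nested _⊛_ terms makes Agda unfold the Cauchy proofs inside ℝ.
  approximant-⊛ : ∀ m {F} G H → F ≡ G ⊛ H → approximant m F ≗ approximant m G ⊗ approximant m H
  approximant-⊛ m G H refl n = seq-sum {suc n} (λ i → G (toℕ i) *ʳ H (n ℕ.∸ toℕ i)) m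

  approximant-∫ : ∀ m F → approximant m (∫ F) ≗ integral (approximant m F)
  approximant-∫ m F zero    = refl
  approximant-∫ m F (suc n) = refl

  integral-cong : ∀ {f g} → f ≗ g → integral f ≗ integral g
  integral-cong f≗g zero    = refl
  integral-cong f≗g (suc n) = cong ((+ 1 / suc n) *_) (f≗g n)

  integral-· : ∀ c f → integral (c · f) ≗ c · integral f
  integral-· c f zero    = sym (ℚ.*-zeroʳ c)
  integral-· c f (suc n) = solve 3 (λ k c x → k :* (c :* x) := c :* (k :* x)) refl
    (+ 1 / suc n) c (f n)

  #-/ : ∀ m n .{{_ : ℕ.NonZero n}} → # n * (+ m / n) ≡ # m
  #-/ m n@(suc d) = ℚ.toℚᵘ-injective (ℚᵘ.≃-trans
    (ℚ.toℚᵘ-homo-* (# n) (+ m / n))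
    (ℚᵘ.≃-trans (ℚᵘ.*-congˡ {ℚ.toℚᵘ (# n)} (ℚ.toℚᵘ-fromℚᵘ (ℚᵘ.mkℚᵘ (+ m) d)))
      (ℚᵘ.*≡* arith)))
    where
    arith : (+ n ℤ.* + m) ℤ.* + 1 ≡ + m ℤ.* + (1 ℕ.* n)
    arith = trans (ℤ.*-identityʳ (+ n ℤ.* + m)) (trans (ℤ.*-comm (+ n) (+ m))
      (cong (λ z → + m ℤ.* + z) (sym (ℕ.*-identityˡ n))))

  D-integral : ∀ f → D (integral f) ≗ f
  D-integral f n = trans (sym (ℚ.*-assoc (# (suc n)) (+ 1 / suc n) (f n)))
    (trans (cong (_* f n) (#-/ 1 (suc n))) (ℚ.*-identityˡ (f n)))

  -- These are e^(e^x - 1) and e^(-e^x + x + 1): the two exponentials of the statement without their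
  -- scalar factors e and 1/e.
  U V : Seq
  U = Exp₀ eˣ
  V = Exp₀ ((⊖ eˣ) ⊕ X)

  D-X : D X ≗ 1ˢ
  D-X zero    = refl
  D-X (suc n) = ℚ.*-zeroʳ (# (suc (suc n)))

  -- The exponents add up to x. In the derivative the contributions of e^x and -e^x cancel, leaving
  -- y′ = y with y(0) = 1.
  U⊗V : U ⊗ V ≗ eˣ
  U⊗V = D-unique 1ˢ (λ _ → 0ℚ) refl
    (λ n → trans (D-UV n) (sym (linear (U ⊗ V) n)))
    (λ n → trans (D-eˣ n) (sym (linear eˣ n)))
    where
    linear : ∀ f n → (1ˢ ⊗ f) n + 0ℚ ≡ f n
    linear f n = trans (ℚ.+-identityʳ ((1ˢ ⊗ f) n)) (⊗-identityˡ f n)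

    D-f : D ((⊖ eˣ) ⊕ X) ≗ (-1ℚ · eˣ) ⊕ 1ˢ
    D-f n = begin
      D ((⊖ eˣ) ⊕ X) n       ≡⟨ D-⊕ (⊖ eˣ) X n ⟩
      D (⊖ eˣ) n + D X n     ≡⟨ cong₂ _+_ (trans (D-⊖ eˣ n) (cong -_ (D-eˣ n))) (D-X n) ⟩
      - eˣ n + 1ˢ n          ≡⟨ cong (_+ 1ˢ n) (solve 1 (λ x → :- x := con -1ℚ :* x) refl (eˣ n)) ⟩
      -1ℚ * eˣ n + 1ˢ n      ∎

    D-V : D V ≗ (-1ℚ · (eˣ ⊗ V)) ⊕ V
    D-V n = begin
      D V n                                ≡⟨ D-Exp₀ ((⊖ eˣ) ⊕ X) n ⟩
      (D ((⊖ eˣ) ⊕ X) ⊗ V) n               ≡⟨ ⊗-congʳ V D-f n ⟩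
      (((-1ℚ · eˣ) ⊕ 1ˢ) ⊗ V) n            ≡⟨ ⊗-distribʳ V (-1ℚ · eˣ) 1ˢ n ⟩
      ((-1ℚ · eˣ) ⊗ V) n + (1ˢ ⊗ V) n      ≡⟨ cong₂ _+_ (⊗-·ˡ -1ℚ eˣ V n) (⊗-identityˡ V n) ⟩
      -1ℚ * (eˣ ⊗ V) n + V n               ∎

    D-UV : D (U ⊗ V) ≗ U ⊗ V
    D-UV n = begin
      D (U ⊗ V) n
        ≡⟨ leibniz U V n ⟩
      (D U ⊗ V) n + (U ⊗ D V) n
        ≡⟨ cong₂ _+_ (begin
             (D U ⊗ V) n         ≡⟨ ⊗-congʳ V (D-Exp₀ eˣ) n ⟩
             ((D eˣ ⊗ U) ⊗ V) n  ≡⟨ ⊗-congʳ V (⊗-congʳ U D-eˣ) n ⟩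
             ((eˣ ⊗ U) ⊗ V) n    ≡⟨ ⊗-congʳ V (⊗-comm eˣ U) n ⟩
             ((U ⊗ eˣ) ⊗ V) n    ≡⟨ ⊗-assoc U eˣ V n ⟩
             (U ⊗ (eˣ ⊗ V)) n    ∎)
             (begin
             (U ⊗ D V) n                                  ≡⟨ ⊗-congˡ U D-V n ⟩
             (U ⊗ ((-1ℚ · (eˣ ⊗ V)) ⊕ V)) n               ≡⟨ ⊗-distribˡ U (-1ℚ · (eˣ ⊗ V)) V n ⟩
             (U ⊗ (-1ℚ · (eˣ ⊗ V))) n + (U ⊗ V) n         ≡⟨ cong (_+ (U ⊗ V) n) (⊗-·ʳ -1ℚ U (eˣ ⊗ V) n) ⟩
             -1ℚ * (U ⊗ (eˣ ⊗ V)) n + (U ⊗ V) n           ∎) ⟩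
      (U ⊗ (eˣ ⊗ V)) n + (-1ℚ * (U ⊗ (eˣ ⊗ V)) n + (U ⊗ V) n)
        ≡⟨ solve 2 (λ x y → x :+ (con -1ℚ :* x :+ y) := y) refl ((U ⊗ (eˣ ⊗ V)) n) ((U ⊗ V) n) ⟩
      (U ⊗ V) n ∎

  -- Variation of constants: `U` solves the homogeneous equation y′ = e^x y, and since `U ⊗ V` is
  -- e^x, differentiating the integral contributes the inhomogeneous term e^x g.
  solution : Seq → Seq
  solution g = U ⊗ integral (g ⊗ V)

  D-solution : ∀ g → D (solution g) ≗ (eˣ ⊗ solution g) ⊕ (eˣ ⊗ g)
  D-solution g n = begin
    D (U ⊗ I) n
      ≡⟨ leibniz U I n ⟩
    (D U ⊗ I) n + (U ⊗ D I) n
      ≡⟨ cong₂ _+_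
           (trans (⊗-congʳ I (λ m → trans (D-Exp₀ eˣ m) (⊗-congʳ U D-eˣ m)) n) (⊗-assoc eˣ U I n))
           (begin
             (U ⊗ D I) n        ≡⟨ ⊗-congˡ U (D-integral (g ⊗ V)) n ⟩
             (U ⊗ (g ⊗ V)) n    ≡⟨ ⊗-congˡ U (⊗-comm g V) n ⟩
             (U ⊗ (V ⊗ g)) n    ≡⟨ ⊗-assoc U V g n ⟨
             ((U ⊗ V) ⊗ g) n    ≡⟨ ⊗-congʳ g U⊗V n ⟩
             (eˣ ⊗ g) n         ∎) ⟩
    (eˣ ⊗ (U ⊗ I)) n + (eˣ ⊗ g) n ∎
    where I = integral (g ⊗ V)

  approximant-Exp : ∀ f {q} → f 0 ≡ q → ∀ m → approximant m (Exp f) ≗ expSum q m · Exp₀ f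
  approximant-Exp f refl m n = refl

  embed-≋ : ∀ {f g} → f ≗ g → embed f ≋ embed g
  embed-≋ {f} {g} f≗g n ε 0<ε = 0 , λ _ _ →
    subst (ℚ._< ε) (cong ∣_∣ (sym (trans (cong (_- g n) (f≗g n)) (ℚ.+-inverseʳ (g n))))) 0<ε

  -- Product and integral are linear, so the partial sums `P` and `Q` of the two scalars move to the
  -- front, and all dependence on `m` is in `P * Q`.
  approximant-rhs : ∀ c g f {p} f′ {q} → f 0 ≡ p → f′ 0 ≡ q → ∀ F G →
    G ≡ embed g ⊛ Exp f′ → F ≡ (c • Exp f) ⊛ ∫ G → ∀ m →
    approximant m F ≗ (expSum p m * expSum q m) · (c · (Exp₀ f ⊗ integral (g ⊗ Exp₀ f′)))
  approximant-rhs c g f {p} f′ {q} f₀ f′₀ F G G≡ F≡ m n = begin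
    approximant m F n
      ≡⟨ approximant-⊛ m (c • Exp f) (∫ G) F≡ n ⟩
    (approximant m (c • Exp f) ⊗ approximant m (∫ G)) n
      ≡⟨ ⊗-congʳ (approximant m (∫ G)) (λ i → cong (c *_) (approximant-Exp f f₀ m i)) n ⟩
    ((c · P · Y) ⊗ approximant m (∫ G)) n
      ≡⟨ ⊗-congˡ (c · P · Y) (λ i → begin
           approximant m (∫ G) i
             ≡⟨ approximant-∫ m G i ⟩
           integral (approximant m G) i
             ≡⟨ integral-cong (approximant-⊛ m (embed g) (Exp f′) G≡) i ⟩
           integral (g ⊗ approximant m (Exp f′)) i
             ≡⟨ integral-cong (⊗-congˡ g (approximant-Exp f′ f′₀ m)) i ⟩
           integral (g ⊗ (Q · Z)) i
             ≡⟨ integral-cong (⊗-·ʳ Q g Z) i ⟩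
           integral (Q · (g ⊗ Z)) i
             ≡⟨ integral-· Q (g ⊗ Z) i ⟩
           Q * integral (g ⊗ Z) i ∎) n ⟩
    ((c · P · Y) ⊗ (Q · I)) n
      ≡⟨ ⊗-·ˡ c (P · Y) (Q · I) n ⟩
    c * ((P · Y) ⊗ (Q · I)) n
      ≡⟨ cong (c *_) (trans (⊗-·ˡ P Y (Q · I) n) (cong (P *_) (⊗-·ʳ Q Y I n))) ⟩
    c * (P * (Q * (Y ⊗ I) n))
      ≡⟨ solve 4 (λ c p q s → c :* (p :* (q :* s)) := p :* q :* (c :* s)) refl c P Q ((Y ⊗ I) n) ⟩
    P * Q * (c * (Y ⊗ I) n) ∎
    where
    P = expSum p m
    Q = expSum q m
    Y = Exp₀ f
    Z = Exp₀ f′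
    I = integral (g ⊗ Z)

  embed-≋-limit : ∀ {f} F → (∀ m → approximant m F ≗ (expSum 1ℚ m * expSum -1ℚ m) · f) →
    embed f ≋ F
  embed-≋-limit {f} F F≗ n ε 0<ε = go (product-limit (f n) ε 0<ε)
    where
    go : (∃ λ M → ∀ m → M ℕ.≤ m → ∣ f n - expSum 1ℚ m * expSum -1ℚ m * f n ∣ ℚ.< ε) →
      ∃ λ M → ∀ m → M ℕ.≤ m → ∣ f n - approximant m F n ∣ ℚ.< ε
    go (M , close) = M , λ m M≤m → subst (λ z → ∣ f n - z ∣ ℚ.< ε)
      (sym (F≗ m n)) (close m M≤m)

  embed-≋-product : ∀ c g e f′ {f} → e 0 ≡ 1ℚ → f′ 0 ≡ -1ℚ →
    f ≗ c · (Exp₀ e ⊗ integral (g ⊗ Exp₀ f′)) → ∀ F G →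
    G ≡ embed g ⊛ Exp f′ → F ≡ (c • Exp e) ⊛ ∫ G → embed f ≋ F
  embed-≋-product c g e f′ e₀ f′₀ f≗ F G G≡ F≡ = embed-≋-limit F λ m n →
    trans (approximant-rhs c g e f′ e₀ f′₀ F G G≡ F≡ m n)
      (cong (expSum 1ℚ m * expSum -1ℚ m *_) (sym (f≗ n)))

  embed-≋-solution : ∀ c g {f} → f ≗ c · solution g → ∀ f′ → f′ ≡ (⊖ eˣ) ⊕ X → ∀ F G →
    G ≡ embed g ⊛ Exp f′ → F ≡ (c • Exp eˣ) ⊛ ∫ G → embed f ≋ F
  embed-≋-solution c g {f} f≗ f′ f′≡ F G G≡ F≡ = embed-≋-product c g eˣ f′ refl (cong (λ h → h 0) f′≡)
    (subst (λ h → f ≗ c · (U ⊗ integral (g ⊗ Exp₀ h))) (sym f′≡) f≗) F G G≡ F≡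

  -- With constant term 0 the scalar is e^0, each of whose partial sums is exactly 1, so the two
  -- sequences coincide and no limit is taken.
  embed-≋-Exp : ∀ h → h 0 ≡ 0ℚ → ∀ {f} → f ≗ Exp₀ h → embed f ≋ Exp h
  embed-≋-Exp h h₀ {f} f≗ n ε 0<ε = 0 , λ m _ → subst (λ z → ∣ f n - z ∣ ℚ.< ε)
    (trans (f≗ n) (sym (trans (cong (_* Exp₀ h n) (trans (cong (λ z → expSum z m) h₀) (expSum-0 m)))
      (ℚ.*-identityˡ (Exp₀ h n)))))
    (subst (ℚ._< ε) (cong ∣_∣ (sym (ℚ.+-inverseʳ (f n)))) 0<ε)

-- Exponential generating functions

module _ where

  open ≡-Reasoning

  /-# : ∀ m n .{{_ : ℕ.NonZero n}} → + m / n ≡ # m * (+ 1 / n)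
  /-# m n@(suc d) = #-cancel d (begin
    # n * (+ m / n)          ≡⟨ #-/ m n ⟩
    # m                      ≡⟨ ℚ.*-identityʳ (# m) ⟨
    # m * 1ℚ                 ≡⟨ cong (# m *_) (#-/ 1 n) ⟨
    # m * (# n * (+ 1 / n))  ≡⟨ solve 3 (λ x y z → x :* (y :* z) := y :* (x :* z)) refl (# m) (# n) (+ 1 / n) ⟩
    # n * (# m * (+ 1 / n))  ∎)

  #-+ : ∀ m n → # (m ℕ.+ n) ≡ # m + # n
  #-+ zero    n = sym (ℚ.+-identityˡ (# n))
  #-+ (suc m) n = begin
    # (suc (m ℕ.+ n))      ≡⟨ #-suc (m ℕ.+ n) ⟩
    # (m ℕ.+ n) + 1ℚ       ≡⟨ cong (_+ 1ℚ) (#-+ m n) ⟩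
    # m + # n + 1ℚ         ≡⟨ solve 2 (λ x y → x :+ y :+ con 1ℚ := x :+ con 1ℚ :+ y) refl (# m) (# n) ⟩
    # m + 1ℚ + # n         ≡⟨ cong (_+ # n) (#-suc m) ⟨
    # (suc m) + # n        ∎

  egf : (ℕ → ℕ) → Seq
  egf f n = # (f n) * 1/ n !

  egf-cong : ∀ {f g} → f ≗ g → egf f ≗ egf g
  egf-cong f≗g n = cong (λ z → # z * 1/ n !) (f≗g n)

  egf-+ : ∀ f g → egf (λ n → f n ℕ.+ g n) ≗ egf f ⊕ egf g
  egf-+ f g n = trans (cong (_* 1/ n !) (#-+ (f n) (g n)))
    (ℚ.*-distribʳ-+ (1/ n !) (# (f n)) (# (g n)))

  D-egf : ∀ f → D (egf f) ≗ egf (f ∘ suc)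
  D-egf f n = begin
    # (suc n) * (# (f (suc n)) * 1/ suc n !)
      ≡⟨ solve 3 (λ x y z → x :* (y :* z) := y :* (z :* x)) refl (# (suc n)) (# (f (suc n))) (1/ suc n !) ⟩
    # (f (suc n)) * (1/ suc n ! * # (suc n))
      ≡⟨ cong (# (f (suc n)) *_) (1/!-suc n) ⟩
    # (f (suc n)) * 1/ n ! ∎

  -- Under `D`, which shifts the counting sequence, Pascal's rule becomes the Leibniz rule for e^x
  -- times `egf f`.
  egf-binom : ∀ f → egf (binom f) ≗ eˣ ⊗ egf f
  egf-binom f zero    = sym (trans (ℚ.+-identityʳ (1ℚ * egf f 0)) (ℚ.*-identityˡ (egf f 0)))
  egf-binom f (suc n) = #-cancel n (begin
    D (egf (binom f)) n
      ≡⟨ D-egf (binom f) n ⟩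
    egf (λ i → binom (f ∘ suc) i ℕ.+ binom f i) n
      ≡⟨ egf-+ (binom (f ∘ suc)) (binom f) n ⟩
    egf (binom (f ∘ suc)) n + egf (binom f) n
      ≡⟨ cong₂ _+_ (egf-binom (f ∘ suc) n) (egf-binom f n) ⟩
    (eˣ ⊗ egf (f ∘ suc)) n + (eˣ ⊗ egf f) n
      ≡⟨ cong₂ _+_ (⊗-congˡ eˣ (D-egf f) n) (⊗-congʳ (egf f) D-eˣ n) ⟨
    (eˣ ⊗ D (egf f)) n + (D eˣ ⊗ egf f) n
      ≡⟨ ℚ.+-comm ((eˣ ⊗ D (egf f)) n) ((D eˣ ⊗ egf f) n) ⟩
    (D eˣ ⊗ egf f) n + (eˣ ⊗ D (egf f)) n
      ≡⟨ leibniz eˣ (egf f) n ⟨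
    D (eˣ ⊗ egf f) n ∎)

  tail-X : tail X ≗ 1ˢ
  tail-X zero    = refl
  tail-X (suc _) = refl

  X-⊗ : ∀ f n → (X ⊗ f) (suc n) ≡ f n
  X-⊗ f n = begin
    0ℚ * f (suc n) + (tail X ⊗ f) n  ≡⟨ cong (_+ (tail X ⊗ f) n) (ℚ.*-zeroˡ (f (suc n))) ⟩
    0ℚ + (tail X ⊗ f) n              ≡⟨ ℚ.+-identityˡ ((tail X ⊗ f) n) ⟩
    (tail X ⊗ f) n                   ≡⟨ ⊗-congʳ f tail-X n ⟩
    (1ˢ ⊗ f) n                       ≡⟨ ⊗-identityˡ f n ⟩
    f n                              ∎

  egf-δ : ∀ j → j ≡ 1 ⊎ j ≡ 2 → egf (δ j) ≗ 1/ j ! · (X ^ˢ j)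
  egf-δ .1 (inj₁ refl) zero          = refl
  egf-δ .1 (inj₁ refl) (suc zero)    = refl
  egf-δ .1 (inj₁ refl) n@(suc (suc m)) = trans (ℚ.*-zeroˡ (1/ n !))
    (sym (trans (cong (1/ 1 ! *_) (X-⊗ 1ˢ (suc m))) (ℚ.*-zeroʳ (1/ 1 !))))
  egf-δ .2 (inj₂ refl) zero             = refl
  egf-δ .2 (inj₂ refl) (suc zero)       = refl
  egf-δ .2 (inj₂ refl) (suc (suc zero)) = refl
  egf-δ .2 (inj₂ refl) n@(suc (suc (suc m))) = trans (ℚ.*-zeroˡ (1/ n !))
    (sym (trans (cong (1/ 2 ! *_) (trans (X-⊗ (X ⊗ 1ˢ) (suc (suc m))) (X-⊗ 1ˢ (suc m)))) (ℚ.*-zeroʳ (1/ 2 !))))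

  counts : ℕ → ℕ → ℕ
  counts j n = count j n n

  -- Unfolding leaves every size i ≤ n with fuel n rather than i; `count-stable` reconciles the two.
  counts-suc : ∀ j n → counts j (suc n) ≡ binom (λ i → counts j i ℕ.+ δ j i) n
  counts-suc j n = binom-cong n λ i i≤n → cong (ℕ._+ δ j i) (count-stable j i i≤n ℕ.≤-refl)

  D-counts : ∀ j → D (egf (counts j)) ≗ eˣ ⊗ egf (λ i → counts j i ℕ.+ δ j i)
  D-counts j n = begin
    D (egf (counts j)) n                              ≡⟨ D-egf (counts j) n ⟩
    egf (counts j ∘ suc) n                            ≡⟨ egf-cong (counts-suc j) n ⟩
    egf (binom (λ i → counts j i ℕ.+ δ j i)) n        ≡⟨ egf-binom (λ i → counts j i ℕ.+ δ j i) n ⟩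
    (eˣ ⊗ egf (λ i → counts j i ℕ.+ δ j i)) n         ∎

  egf-counts : ∀ j → j ≡ 1 ⊎ j ≡ 2 → egf (counts j) ≗ 1/ j ! · solution (X ^ˢ j)
  egf-counts j j≡ = D-unique eˣ (eˣ ⊗ (c · (X ^ˢ j))) zero≡ left right
    where
    c = 1/ j !
    g = X ^ˢ j
    zero≡ : # 0 * 1/ 0 ! ≡ c * solution g 0
    zero≡ = sym (trans (cong (λ z → c * (z + 0ℚ)) (ℚ.*-zeroʳ (U 0))) (ℚ.*-zeroʳ c))

    left : D (egf (counts j)) ≗ (eˣ ⊗ egf (counts j)) ⊕ (eˣ ⊗ (c · g))
    left n = begin
      D (egf (counts j)) n
        ≡⟨ D-counts j n ⟩
      (eˣ ⊗ egf (λ i → counts j i ℕ.+ δ j i)) n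
        ≡⟨ ⊗-congˡ eˣ (λ m → trans (egf-+ (counts j) (δ j) m) (cong (λ z → egf (counts j) m + z) (egf-δ j j≡ m))) n ⟩
      (eˣ ⊗ (egf (counts j) ⊕ (c · g))) n
        ≡⟨ ⊗-distribˡ eˣ (egf (counts j)) (c · g) n ⟩
      (eˣ ⊗ egf (counts j)) n + (eˣ ⊗ (c · g)) n ∎

    right : D (c · solution g) ≗ (eˣ ⊗ (c · solution g)) ⊕ (eˣ ⊗ (c · g))
    right n = begin
      D (c · solution g) n
        ≡⟨ D-· c (solution g) n ⟩
      c * D (solution g) n
        ≡⟨ cong (c *_) (D-solution g n) ⟩
      c * ((eˣ ⊗ solution g) n + (eˣ ⊗ g) n)
        ≡⟨ ℚ.*-distribˡ-+ c ((eˣ ⊗ solution g) n) ((eˣ ⊗ g) n) ⟩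
      c * (eˣ ⊗ solution g) n + c * (eˣ ⊗ g) n
        ≡⟨ cong₂ _+_ (⊗-·ʳ c eˣ (solution g) n) (⊗-·ʳ c eˣ g n) ⟨
      (eˣ ⊗ (c · solution g)) n + (eˣ ⊗ (c · g)) n ∎

  eˣ-1 : Seq
  eˣ-1 = eˣ ⊕ (⊖ 1ˢ)

  -- `δ 0` accounts for the empty permutation, which begins with 1 by convention but is absent from
  -- `counts`.
  N-1 : ∀ n → N (pattern-k 1) n ≡ counts 0 n ℕ.+ δ 0 n
  N-1 zero    = refl
  N-1 (suc n) = trans (N≡count (pattern-k 1) 0 (suc n) begins-1) (sym (ℕ.+-identityʳ (counts 0 (suc n))))

  -- Including the empty permutation absorbs the inhomogeneous term: the equation becomes y′ = e^x y
  -- with y(0) = 1, which e^(e^x - 1) solves.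
  egf-N-1 : egf (N (pattern-k 1)) ≗ Exp₀ eˣ-1
  egf-N-1 = D-unique eˣ (λ _ → 0ℚ) refl
    (λ n → begin
      D (egf (N (pattern-k 1))) n                     ≡⟨ D-egf (N (pattern-k 1)) n ⟩
      egf (N (pattern-k 1) ∘ suc) n                   ≡⟨ egf-cong (λ m → N≡count (pattern-k 1) 0 (suc m) begins-1) n ⟩
      egf (counts 0 ∘ suc) n                          ≡⟨ D-egf (counts 0) n ⟨
      D (egf (counts 0)) n                            ≡⟨ D-counts 0 n ⟩
      (eˣ ⊗ egf (λ i → counts 0 i ℕ.+ δ 0 i)) n       ≡⟨ ⊗-congˡ eˣ (egf-cong N-1) n ⟨
      (eˣ ⊗ egf (N (pattern-k 1))) n                  ≡⟨ ℚ.+-identityʳ _ ⟨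
      (eˣ ⊗ egf (N (pattern-k 1))) n + 0ℚ             ∎)
    (λ n → begin
      D (Exp₀ eˣ-1) n               ≡⟨ D-Exp₀ eˣ-1 n ⟩
      (D eˣ-1 ⊗ Exp₀ eˣ-1) n        ≡⟨ ⊗-congʳ (Exp₀ eˣ-1) D-eˣ-1 n ⟩
      (eˣ ⊗ Exp₀ eˣ-1) n            ≡⟨ ℚ.+-identityʳ _ ⟨
      (eˣ ⊗ Exp₀ eˣ-1) n + 0ℚ       ∎)
    where
    D-eˣ-1 : D eˣ-1 ≗ eˣ
    D-eˣ-1 n = trans (cong (# (suc n) *_) (ℚ.+-identityʳ (eˣ (suc n)))) (D-eˣ n)

  -- The three cases of the formula

  E≗egf : ∀ {k} (p : Vec ℕ k) n → (+ N p n / (n !)) {{n ℕ.!≢0}} ≡ egf (N p) n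
  E≗egf p n = /-# (N p n) (n !) {{n ℕ.!≢0}}

  N≗counts : ∀ k → k ≡ 2 ⊎ k ≡ 3 → N (pattern-k k) ≗ counts (k ∸ 1)
  N≗counts .2 (inj₁ refl) n = N≡count (pattern-k 2) 1 n begins-2
  N≗counts .3 (inj₂ refl) n = N≡count (pattern-k 3) 2 n begins-3

  predecessor : ∀ k → k ≡ 2 ⊎ k ≡ 3 → k ∸ 1 ≡ 1 ⊎ k ∸ 1 ≡ 2
  predecessor .2 (inj₁ refl) = inj₁ refl
  predecessor .3 (inj₂ refl) = inj₂ refl

  E-solution : ∀ k → k ≡ 2 ⊎ k ≡ 3 → ∀ n →
    (+ N (pattern-k k) n / (n !)) {{n ℕ.!≢0}} ≡ (1/ (k ∸ 1) ! · solution (X ^ˢ (k ∸ 1))) n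
  E-solution k h n = begin
    (+ N (pattern-k k) n / (n !)) {{n ℕ.!≢0}}  ≡⟨ E≗egf (pattern-k k) n ⟩
    egf (N (pattern-k k)) n                    ≡⟨ egf-cong (N≗counts k h) n ⟩
    egf (counts (k ∸ 1)) n                     ≡⟨ egf-counts (k ∸ 1) (predecessor k h) n ⟩
    (1/ (k ∸ 1) ! · solution (X ^ˢ (k ∸ 1))) n ∎

  E-4 : ∀ k → 4 ≤ k → E (pattern-k k) ≋ 0ˢ
  E-4 (suc (suc (suc (suc i)))) (s≤s (s≤s (s≤s (s≤s z≤n)))) =
    embed-≋ {λ n → (+ N (pattern-k (4 ℕ.+ i)) n / (n !)) {{n ℕ.!≢0}}} {λ _ → 0ℚ} λ n → begin
    (+ N (pattern-k (4 ℕ.+ i)) n / (n !)) {{n ℕ.!≢0}}  ≡⟨ E≗egf (pattern-k (4 ℕ.+ i)) n ⟩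
    # (N (pattern-k (4 ℕ.+ i)) n) * 1/ n !             ≡⟨ cong (λ z → # z * 1/ n !) (N-pattern-4 i n) ⟩
    0ℚ * 1/ n !                                        ≡⟨ ℚ.*-zeroˡ (1/ n !) ⟩
    0ℚ                                                 ∎

E-≋ : ∀ k → k ≡ 2 ⊎ k ≡ 3 → ∀ g → g ≡ X ^ˢ (k ∸ 1) → ∀ f′ → f′ ≡ (⊖ eˣ) ⊕ X → ∀ F G →
  G ≡ embed g ⊛ Exp f′ → F ≡ ((1/ (k ∸ 1) !) • Exp eˣ) ⊛ ∫ G → E (pattern-k k) ≋ F
E-≋ k h g g≡ f′ f′≡ F G G≡ F≡ = embed-≋-solution (1/ (k ∸ 1) !) g
  (subst (λ g → (λ n → (+ N (pattern-k k) n / (n !)) {{n ℕ.!≢0}}) ≗ 1/ (k ∸ 1) ! · solution g)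
    (sym g≡) (E-solution k h))
  f′ f′≡ F G G≡ F≡

proposition27 : ∀ (k : ℕ) → 1 ≤ k →
    (4 ≤ k → E (pattern-k k) ≋ 0ˢ) ×
    (k ≡ 2 ⊎ k ≡ 3 →
    E (pattern-k k) ≋
    ((1/ (k ∸ 1) !) • Exp eˣ) ⊛ ∫ (embed (X ^ˢ (k ∸ 1)) ⊛ Exp ((⊖ eˣ) ⊕ X))) ×
    (k ≡ 1 → E (pattern-k k) ≋ Exp (eˣ ⊕ (⊖ 1ˢ)))
proposition27 k _ =
  E-4 k ,
  (λ h → E-≋ k h _ refl _ refl _ _ refl refl) ,
  λ { refl → embed-≋-Exp eˣ-1 refl λ n → trans (E≗egf (pattern-k 1) n) (egf-N-1 n) }
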